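{- Let $P$ be the level poset of an $n\times n$ binary matrix $M$. Then the $n\times n$ matrix $\Psi=(\Psi_{x,y})$ of the $\mathbf{a}\mathbf{b}$-series of $P$ is the unique $n\times n$ matrix with entries in $\mathbb{R}\langle\langle\mathbf{a},\mathbf{b}\rangle\rangle$ satisfying the system of equations $$\left.\Psi\right|_{\mathbf{a}=t,\ \mathbf{b}=0}=K(t),\qquad \Delta(\Psi)=\Psi\cdot\mathbf{t}\cdot\Psi ,$$ where $K(t)=M+\operatorname{Bin}(M^2)\,t+\operatorname{Bin}(M^3)\,t^2+\cdots$ and the derivation $\Delta$ is applied entrywise.
   Context: For a nonnegative square matrix $A$, $\operatorname{Bin}(A)$ is the $0/1$ matrix obtained by replacing each nonzero entry of $A$ by $1$. Level poset: let $M$ be a $0/1$ square matrix with rows and columns indexed by a finite nonempty set $V$. The level poset of $M$ is the poset on $V\times\mathbb{Z}$ with $(u,i)<(v,j)$ if and only if $i<j$ and $(M^{j-i})_{u,v}>0$; the second coordinate is its rank function. $\mathbf{a}\mathbf{b}$-index: for a finite graded poset $Q$ of rank $m+1$ with minimum $\hat0$, maximum $\hat1$ and rank function $\rho$, and a chain $c=\{\hat0=x_0<x_1<\cdots<x_{k+1}=\hat1\}$, put $$\operatorname{wt}(c)=(\mathbf{a}-\mathbf{b})^{\rho(x_0,x_1)-1}\cdot\mathbf{b}\cdot(\mathbf{a}-\mathbf{b})^{\rho(x_1,x_2)-1}\cdot\mathbf{b}\cdots\mathbf{b}\cdot(\mathbf{a}-\mathbf{b})^{\rho(x_k,x_{k+1})-1},$$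 where $\rho(x,y)=\rho(y)-\rho(x)$ and $\mathbf{a},\mathbf{b}$ are non-commuting variables of degree one. Then $\Psi(Q)=\sum_c\operatorname{wt}(c)$, summed over all chains $c$ containing $\hat0$ and $\hat1$; it is homogeneous of degree $m$. $\mathbf{a}\mathbf{b}$-series: $\Psi_{x,y}=\sum_{m\ge0}\Psi([(x,0),(y,m+1)])\in\mathbb{R}\langle\langle\mathbf{a},\mathbf{b}\rangle\rangle$, where $\Psi([(x,0),(y,m+1)])$ is taken to be $0$ if $(x,0)\not\le(y,m+1)$. Derivation: $\Delta:\mathbb{R}\langle\langle\mathbf{a},\mathbf{b}\rangle\rangle\to\mathbb{R}\langle\langle\mathbf{a},\mathbf{b},\mathbf{t}\rangle\rangle$ is the (degree-by-degree extended) linear map with $\Delta(1)=0$, $\Delta(\mathbf{a})=\Delta(\mathbf{b})=\mathbf{t}$ and $\Delta(u\cdot v)=\Delta(u)\cdot v+u\cdot\Delta(v)$, where $\mathbf{t}$ is a third non-commuting variable. The variable $t$ in $K(t)$ is an ordinary formal variable, unrelated to $\mathbf{t}$. -}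

module Defs where

open import Algebra.Bundles using (CommutativeRing; RawRing; RawSemiring)
import Algebra.Definitions.RawSemiring as RawSemiringDefinitions
open import Data.Bool.Base using (if_then_else_)
open import Data.Fin.Base using (Fin; inject₁)
open import Data.Fin.Patterns using (0F; 1F; 2F)
import Data.Fin.Properties as Fin
open import Data.Integer.Base as ℤ using (ℤ; +_)
import Data.Integer.Properties as ℤ
open import Data.List.Base
  using (List; []; _∷_; _++_; [_]; map; filter; foldr; concatMap; length; upTo; allFin;
         cartesianProduct; cartesianProductWith)
import Data.List.Properties as List
open import Data.List.Membership.Propositional using (_∈_)
open import Data.List.Membership.Propositional.Properties
  using (∈-filter⁺; ∈-filter⁻; ∈-cartesianProduct⁺; ∈-allFin; ∈-map⁺; ∈-upTo⁺)
open import Data.List.Relation.Unary.Linked using (linked?)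
open import Data.List.Relation.Unary.Unique.Propositional using (Unique)
import Data.List.Relation.Unary.Unique.Propositional.Properties as Unique
open import Data.Nat.Base as ℕ using (ℕ; zero; suc; _∸_)
import Data.Nat.Properties as ℕ
open import Data.Product.Base using (∃; _×_; _,_; proj₁; proj₂; map₁)
open import Data.Product.Properties using (≡-dec)
import Data.Rational.Properties as ℚ
open import Data.Rational.Solver using (module +-*-Solver)
open import Data.Sum.Base using (_⊎_; inj₁; inj₂)
open import Level using (0ℓ)
open import Relation.Binary.Core using (Rel)
open import Relation.Binary.Definitions using (Decidable; DecidableEquality)
open import Relation.Binary.PropositionalEquality
  using (_≡_; _≗_; refl; sym; trans; cong; subst; subst₂; isEquivalence)
open import Relation.Binary.Structures using (IsStrictPartialOrder)
import Relation.Binary.Construct.StrictToNonStrict as StrictToNonStrict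
open import Relation.Nullary.Decidable using (does; yes; no; _×-dec_)
open import Relation.Nullary.Negation using (¬_; contradiction)

module RealNumbers where

  open import Data.Rational.Base

  -- Two sequences of rationals approach the same limit.  A sequence is Cauchy
  -- exactly when it is related to itself, and on Cauchy sequences this is the
  -- usual equivalence modulo null sequences.
  infix 4 _∼_
  record _∼_ (x y : ℕ → ℚ) : Set where
    constructor mk∼
    field
      within : ∀ ε → 0ℚ < ε →
        ∃ λ N → ∀ m n → N ℕ.≤ m → N ℕ.≤ n → ∣ x m - y n ∣ < ε

  open _∼_

  record ℝ : Set where
    constructor mkℝ
    field
      seq    : ℕ → ℚ
      cauchy : seq ∼ seq

  open ℝ public

  infix 4 _≈ᴿ_
  _≈ᴿ_ : ℝ → ℝ → Set
  x ≈ᴿ y = seq x ∼ seq y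

  abstract

    half>0 : ∀ {ε} → 0ℚ < ε → 0ℚ < ½ * ε
    half>0 {ε} 0<ε = subst (_< ½ * ε) (ℚ.*-zeroʳ ½) (ℚ.*-monoʳ-<-pos ½ 0<ε)

    halves : ∀ ε → ½ * ε + ½ * ε ≡ ε
    halves ε = trans (sym (ℚ.*-distribʳ-+ ε ½ ½)) (ℚ.*-identityˡ ε)

    small-+ : ∀ p q {r s} → ∣ p ∣ < r → ∣ q ∣ < s → ∣ p + q ∣ < r + s
    small-+ p q p<r q<s = ℚ.≤-<-trans (ℚ.∣p+q∣≤∣p∣+∣q∣ p q) (ℚ.+-mono-< p<r q<s)

    ∼-sym : ∀ {x y} → x ∼ y → y ∼ x
    within (∼-sym {x} {y} x∼y) ε 0<ε with within x∼y ε 0<ε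
    ... | N , close = N , λ m n N≤m N≤n →
      subst (_< ε) (trans (sym (ℚ.∣-p∣≡∣p∣ (x n - y m))) (cong ∣_∣ (flip (x n) (y m)))) (close n m N≤n N≤m)
      where
      open +-*-Solver
      flip : ∀ p q → - (p - q) ≡ q - p
      flip = solve 2 (λ p q → :- (p :- q) := q :- p) refl

    ∼-trans : ∀ {x y z} → x ∼ y → y ∼ z → x ∼ z
    within (∼-trans {x} {y} {z} x∼y y∼z) ε 0<ε
      with within x∼y (½ * ε) (half>0 0<ε) | within y∼z (½ * ε) (half>0 0<ε)
    ... | N₁ , close₁ | N₂ , close₂ = N₁ ℕ.⊔ N₂ , λ m n N≤m N≤n →
      let k = N₁ ℕ.⊔ N₂ in
      subst₂ _<_ (cong ∣_∣ (telescope (x m) (y k) (z n))) (halves ε)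
        (small-+ (x m - y k) (y k - z n)
          (close₁ m k (ℕ.m⊔n≤o⇒m≤o N₁ N₂ N≤m) (ℕ.m≤m⊔n N₁ N₂))
          (close₂ k n (ℕ.m≤n⊔m N₁ N₂) (ℕ.m⊔n≤o⇒n≤o N₁ N₂ N≤n)))
      where
      open +-*-Solver
      telescope : ∀ p q r → (p - q) + (q - r) ≡ p - r
      telescope = solve 3 (λ p q r → (p :- q) :+ (q :- r) := p :- r) refl

    ≗⇒∼ : ∀ {x y} → y ∼ y → x ≗ y → x ∼ y
    within (≗⇒∼ {x} {y} y∼y x≗y) ε 0<ε with within y∼y ε 0<ε
    ... | N , close = N , λ m n N≤m N≤n →
      subst (λ p → ∣ p - y n ∣ < ε) (sym (x≗y m)) (close m n N≤m N≤n)

    const-∼ : ∀ p → (λ _ → p) ∼ (λ _ → p)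
    within (const-∼ p) ε 0<ε = 0 , λ _ _ _ _ →
      subst (λ q → ∣ q ∣ < ε) (sym (ℚ.+-inverseʳ p)) 0<ε

    neg-∼ : ∀ {x y} → x ∼ y → (λ n → - x n) ∼ (λ n → - y n)
    within (neg-∼ {x} {y} x∼y) ε 0<ε with within x∼y ε 0<ε
    ... | N , close = N , λ m n N≤m N≤n →
      subst (_< ε) (trans (sym (ℚ.∣-p∣≡∣p∣ (x m - y n))) (cong ∣_∣ (ℚ.neg-distrib-+ (x m) (- y n))))
        (close m n N≤m N≤n)

    +-∼ : ∀ {x x′ y y′} → x ∼ x′ → y ∼ y′ → (λ n → x n + y n) ∼ (λ n → x′ n + y′ n)
    within (+-∼ {x} {x′} {y} {y′} x∼x′ y∼y′) ε 0<ε
      with within x∼x′ (½ * ε) (half>0 0<ε) | within y∼y′ (½ * ε) (half>0 0<ε)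
    ... | N₁ , close₁ | N₂ , close₂ = N₁ ℕ.⊔ N₂ , λ m n N≤m N≤n →
      subst₂ _<_ (cong ∣_∣ (shuffle (x m) (x′ n) (y m) (y′ n))) (halves ε)
        (small-+ (x m - x′ n) (y m - y′ n)
          (close₁ m n (ℕ.m⊔n≤o⇒m≤o N₁ N₂ N≤m) (ℕ.m⊔n≤o⇒m≤o N₁ N₂ N≤n))
          (close₂ m n (ℕ.m⊔n≤o⇒n≤o N₁ N₂ N≤m) (ℕ.m⊔n≤o⇒n≤o N₁ N₂ N≤n)))
      where
      open +-*-Solver
      shuffle : ∀ p p′ q q′ → (p - p′) + (q - q′) ≡ (p + q) - (p′ + q′)
      shuffle = solve 4 (λ p p′ q q′ → (p :- p′) :+ (q :- q′) := (p :+ q) :- (p′ :+ q′)) refl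

    bounded : ∀ {x} → x ∼ x →
              ∃ λ B → Positive B × ∃ λ N → ∀ n → N ℕ.≤ n → ∣ x n ∣ < B
    bounded {x} x∼x with within x∼x 1ℚ (ℚ.positive⁻¹ 1ℚ)
    ... | N , close =
      1ℚ + ∣ x N ∣ , ℚ.pos+nonNeg⇒pos 1ℚ ∣ x N ∣ {{ℚ.∣-∣-nonNeg (x N)}} , N , λ n N≤n →
        subst (λ p → ∣ p ∣ < 1ℚ + ∣ x N ∣) (restore (x n) (x N))
          (ℚ.≤-<-trans (ℚ.∣p+q∣≤∣p∣+∣q∣ (x n - x N) (x N))
            (ℚ.+-monoˡ-< ∣ x N ∣ (close n N N≤n ℕ.≤-refl)))
      where
      open +-*-Solver
      restore : ∀ p q → (p - q) + q ≡ p
      restore = solve 2 (λ p q → (p :- q) :+ q := p) refl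

    small-* : ∀ p q {B δ} → Positive B → ∣ p ∣ < B → ∣ q ∣ < δ → ∣ p * q ∣ < B * δ
    small-* p q {B} posB p<B q<δ = subst (_< _) (sym (ℚ.∣p*q∣≡∣p∣*∣q∣ p q))
      (ℚ.≤-<-trans
        (ℚ.*-monoʳ-≤-nonNeg ∣ q ∣ {{ℚ.∣-∣-nonNeg q}} (ℚ.<⇒≤ p<B))
        (ℚ.*-monoʳ-<-pos B {{posB}} q<δ))

    divide : ∀ D → Positive D → ∀ {ε} → 0ℚ < ε → ∃ λ δ → 0ℚ < δ × D * δ ≡ ε
    divide D posD {ε} 0<ε = D⁻¹ * ε ,
      subst (_< D⁻¹ * ε) (ℚ.*-zeroʳ D⁻¹) (ℚ.*-monoʳ-<-pos D⁻¹ {{ℚ.1/pos⇒pos D {{posD}}}} 0<ε) ,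
      trans (sym (ℚ.*-assoc D D⁻¹ ε))
        (trans (cong (_* ε) (ℚ.*-inverseʳ D {{D≢0}})) (ℚ.*-identityˡ ε))
      where
      D≢0 : NonZero D
      D≢0 = ℚ.pos⇒nonZero D {{posD}}

      D⁻¹ : ℚ
      D⁻¹ = (1/ D) {{D≢0}}

    close-* : ∀ p p′ q q′ {B C δ ε} → Positive B → Positive C → (B + C) * δ ≡ ε →
              ∣ p ∣ < B → ∣ q′ ∣ < C → ∣ p - p′ ∣ < δ → ∣ q - q′ ∣ < δ →
              ∣ p * q - p′ * q′ ∣ < ε
    close-* p p′ q q′ {B} {C} {δ} posB posC eq p<B q′<C p-p′<δ q-q′<δ =
      subst₂ _<_ (cong ∣_∣ (expand p p′ q q′)) (trans (sym (ℚ.*-distribʳ-+ δ B C)) eq)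
        (small-+ (p * (q - q′)) (q′ * (p - p′))
          (small-* p (q - q′) posB p<B q-q′<δ)
          (small-* q′ (p - p′) posC q′<C p-p′<δ))
      where
      open +-*-Solver
      expand : ∀ p p′ q q′ → p * (q - q′) + q′ * (p - p′) ≡ p * q - p′ * q′
      expand = solve 4 (λ p p′ q q′ →
        p :* (q :- q′) :+ q′ :* (p :- p′) := p :* q :- p′ :* q′) refl

    *-∼ : ∀ {x x′ y y′} → x ∼ x′ → y ∼ y′ → (λ n → x n * y n) ∼ (λ n → x′ n * y′ n)
    *-∼ {x} {x′} {y} {y′} x∼x′ y∼y′ = mk∼ λ ε 0<ε →
      let (B , posB , K₁ , x<B)  = bounded (∼-trans x∼x′ (∼-sym x∼x′))
          (C , posC , K₂ , y′<C) = bounded (∼-trans (∼-sym y∼y′) y∼y′)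
          (δ , 0<δ , eq)         = divide (B + C) (ℚ.pos+pos⇒pos B {{posB}} C {{posC}}) 0<ε
          (N₁ , close₁)          = within x∼x′ δ 0<δ
          (N₂ , close₂)          = within y∼y′ δ 0<δ
          K = K₁ ℕ.⊔ K₂
          N = N₁ ℕ.⊔ N₂
      in K ℕ.⊔ N , λ m n K⊔N≤m K⊔N≤n →
        let K≤m = ℕ.m⊔n≤o⇒m≤o K N K⊔N≤m
            K≤n = ℕ.m⊔n≤o⇒m≤o K N K⊔N≤n
            N≤m = ℕ.m⊔n≤o⇒n≤o K N K⊔N≤m
            N≤n = ℕ.m⊔n≤o⇒n≤o K N K⊔N≤n
        in close-* (x m) (x′ n) (y m) (y′ n) posB posC eq
             (x<B m (ℕ.m⊔n≤o⇒m≤o K₁ K₂ K≤m))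
             (y′<C n (ℕ.m⊔n≤o⇒n≤o K₁ K₂ K≤n))
             (close₁ m n (ℕ.m⊔n≤o⇒m≤o N₁ N₂ N≤m) (ℕ.m⊔n≤o⇒m≤o N₁ N₂ N≤n))
             (close₂ m n (ℕ.m⊔n≤o⇒n≤o N₁ N₂ N≤m) (ℕ.m⊔n≤o⇒n≤o N₁ N₂ N≤n))

  infixl 6 _+ᴿ_
  infixl 7 _*ᴿ_

  fromℚ : ℚ → ℝ
  fromℚ p = mkℝ (λ _ → p) (const-∼ p)

  _+ᴿ_ _*ᴿ_ : ℝ → ℝ → ℝ
  x +ᴿ y = mkℝ (λ n → seq x n + seq y n) (+-∼ (cauchy x) (cauchy y))
  x *ᴿ y = mkℝ (λ n → seq x n * seq y n) (*-∼ (cauchy x) (cauchy y))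

  -ᴿ_ : ℝ → ℝ
  -ᴿ x = mkℝ (λ n → - seq x n) (neg-∼ (cauchy x))

  pointwise : ∀ x y → seq x ≗ seq y → x ≈ᴿ y
  pointwise x y = ≗⇒∼ (cauchy y)

  ℝ-commutativeRing : CommutativeRing 0ℓ 0ℓ
  ℝ-commutativeRing = record
    { Carrier = ℝ
    ; _≈_ = _≈ᴿ_
    ; _+_ = _+ᴿ_
    ; _*_ = _*ᴿ_
    ; -_ = -ᴿ_
    ; 0# = fromℚ 0ℚ
    ; 1# = fromℚ 1ℚ
    ; isCommutativeRing = record
      { isRing = record
        { +-isAbelianGroup = record
          { isGroup = record
            { isMonoid = record
              { isSemigroup = record
                { isMagma = record
                  { isEquivalence = record
                    { refl = λ {x} → cauchy x
                    ; sym = ∼-sym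
                    ; trans = ∼-trans
                    }
                  ; ∙-cong = +-∼
                  }
                ; assoc = λ x y z → pointwise ((x +ᴿ y) +ᴿ z) (x +ᴿ (y +ᴿ z))
                    (λ n → ℚ.+-assoc (seq x n) (seq y n) (seq z n))
                }
              ; identity =
                  (λ x → pointwise (fromℚ 0ℚ +ᴿ x) x (λ n → ℚ.+-identityˡ (seq x n))) ,
                  (λ x → pointwise (x +ᴿ fromℚ 0ℚ) x (λ n → ℚ.+-identityʳ (seq x n)))
              }
            ; inverse =
                (λ x → pointwise ((-ᴿ x) +ᴿ x) (fromℚ 0ℚ) (λ n → ℚ.+-inverseˡ (seq x n))) ,
                (λ x → pointwise (x +ᴿ (-ᴿ x)) (fromℚ 0ℚ) (λ n → ℚ.+-inverseʳ (seq x n)))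
            ; ⁻¹-cong = neg-∼
            }
          ; comm = λ x y → pointwise (x +ᴿ y) (y +ᴿ x) (λ n → ℚ.+-comm (seq x n) (seq y n))
          }
        ; *-cong = *-∼
        ; *-assoc = λ x y z → pointwise ((x *ᴿ y) *ᴿ z) (x *ᴿ (y *ᴿ z))
            (λ n → ℚ.*-assoc (seq x n) (seq y n) (seq z n))
        ; *-identity =
            (λ x → pointwise (fromℚ 1ℚ *ᴿ x) x (λ n → ℚ.*-identityˡ (seq x n))) ,
            (λ x → pointwise (x *ᴿ fromℚ 1ℚ) x (λ n → ℚ.*-identityʳ (seq x n)))
        ; distrib =
            (λ x y z → pointwise (x *ᴿ (y +ᴿ z)) ((x *ᴿ y) +ᴿ (x *ᴿ z))
              (λ n → ℚ.*-distribˡ-+ (seq x n) (seq y n) (seq z n))) ,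
            (λ x y z → pointwise ((y +ᴿ z) *ᴿ x) ((y *ᴿ x) +ᴿ (z *ᴿ x))
              (λ n → ℚ.*-distribʳ-+ (seq x n) (seq y n) (seq z n)))
        }
      ; *-comm = λ x y → pointwise (x *ᴿ y) (y *ᴿ x) (λ n → ℚ.*-comm (seq x n) (seq y n))
      }
    }

tuples : ∀ {a} {A : Set a} → List A → ℕ → List (List A)
tuples xs zero    = [ [] ]
tuples xs (suc k) = cartesianProductWith _∷_ xs (tuples xs k)

Matrix : ∀ {a} → Set a → ℕ → Set a
Matrix A n = Fin n → Fin n → A

module MatrixOperations {c ℓ} (S : RawSemiring c ℓ) {n : ℕ} where

  open RawSemiring S
  open RawSemiringDefinitions S using (sum)

  infixl 7 _·_
  infixr 8 _^_

  _·_ : Matrix Carrier n → Matrix Carrier n → Matrix Carrier n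
  (A · B) x y = sum (λ z → A x z * B z y)

  𝟏 : Matrix Carrier n
  𝟏 x y = if does (x Fin.≟ y) then 1# else 0#

  _^_ : Matrix Carrier n → ℕ → Matrix Carrier n
  A ^ zero  = 𝟏
  A ^ suc k = A · (A ^ k)

open MatrixOperations ℕ.+-*-rawSemiring public using () renaming (_^_ to _^ᴺ_)

IsBinary : ∀ {n} → Matrix ℕ n → Set
IsBinary M = ∀ x y → M x y ≡ 0 ⊎ M x y ≡ 1

Bin : ∀ {n} → Matrix ℕ n → Matrix ℕ n
Bin A x y = if does (A x y ℕ.≟ 0) then 0 else 1

record LocallyFiniteGradedPoset : Set₁ where
  infix 4 _<_ _≤_ _<?_ _≤?_ _≟_

  field
    Carrier              : Set
    _<_                  : Rel Carrier 0ℓ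
    isStrictPartialOrder : IsStrictPartialOrder _≡_ _<_
    _≟_                  : DecidableEquality Carrier
    _<?_                 : Decidable _<_

  _≤_ : Rel Carrier 0ℓ
  _≤_ = StrictToNonStrict._≤_ _≡_ _<_

  _≤?_ : Decidable _≤_
  _≤?_ = StrictToNonStrict.decidable _≡_ _<_ _≟_ _<?_

  field
    ρ                    : Carrier → ℤ
    ρ-strictlyMonotone   : ∀ {x y} → x < y → ρ x ℤ.< ρ y
    ρ-cover              : ∀ {x y} → x < y → (∀ z → ¬ (x < z × z < y)) → ρ y ≡ ℤ.suc (ρ x)
    interval             : Carrier → Carrier → List Carrier
    ∈-interval⁺          : ∀ {x y z} → x ≤ z → z ≤ y → z ∈ interval x y
    ∈-interval⁻          : ∀ {x y z} → z ∈ interval x y → x ≤ z × z ≤ y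
    interval-unique      : ∀ x y → Unique (interval x y)

  -- ρ y - ρ x, as a natural number; only used for x ≤ y
  rank : Carrier → Carrier → ℕ
  rank x y = ℤ.∣ ρ y ℤ.- ρ x ∣

  -- A chain x = x₀ < x₁ < ⋯ < xₖ₊₁ = y is represented by the list x₁, …, xₖ.
  -- Ranks increase along a chain, so k < rank x y.
  chains : Carrier → Carrier → List (List Carrier)
  chains x y =
    filter (λ c → linked? _<?_ (x ∷ c ++ [ y ]))
      (concatMap (tuples (interval x y)) (upTo (rank x y)))

module LevelPoset {n : ℕ} (M : Matrix ℕ n) where

  infix 4 _<_ _≤_ _<?_ _≤?_ _≟_

  _<_ : Rel (Fin n × ℤ) 0ℓ
  (u , i) < (v , j) = i ℤ.< j × 0 ℕ.< (M ^ᴺ ℤ.∣ j ℤ.- i ∣) u v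

  _≤_ : Rel (Fin n × ℤ) 0ℓ
  _≤_ = StrictToNonStrict._≤_ _≡_ _<_

  _≟_ : DecidableEquality (Fin n × ℤ)
  _≟_ = ≡-dec Fin._≟_ ℤ._≟_

  _<?_ : Decidable _<_
  (u , i) <? (v , j) = i ℤ.<? j ×-dec 0 ℕ.<? (M ^ᴺ ℤ.∣ j ℤ.- i ∣) u v

  _≤?_ : Decidable _≤_
  _≤?_ = StrictToNonStrict.decidable _≡_ _<_ _≟_ _<?_

  interval : Fin n × ℤ → Fin n × ℤ → List (Fin n × ℤ)
  interval x@(u , i) y@(v , j) =
    filter (λ z → x ≤? z ×-dec z ≤? y)
      (cartesianProduct (allFin n) (map (λ k → i ℤ.+ + k) (upTo (suc ℤ.∣ j ℤ.- i ∣))))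

  open RawSemiringDefinitions ℕ.+-*-rawSemiring using (sum)

  sum>0⁺ : ∀ {k} (f : Fin k → ℕ) x → 0 ℕ.< f x → 0 ℕ.< sum f
  sum>0⁺ f Fin.zero    f>0 = ℕ.<-≤-trans f>0 (ℕ.m≤m+n _ _)
  sum>0⁺ f (Fin.suc x) f>0 = ℕ.<-≤-trans (sum>0⁺ (λ y → f (Fin.suc y)) x f>0) (ℕ.m≤n+m _ _)

  sum>0⁻ : ∀ {k} (f : Fin k → ℕ) → 0 ℕ.< sum f → ∃ λ x → 0 ℕ.< f x
  sum>0⁻ {suc k} f sum>0 with f Fin.zero in eq
  ... | suc _ = Fin.zero , subst (0 ℕ.<_) (sym eq) ℕ.z<s
  ... | zero  = let (x , f>0) = sum>0⁻ (λ y → f (Fin.suc y)) sum>0 in Fin.suc x , f>0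

  *>0⁺ : ∀ {p q} → 0 ℕ.< p → 0 ℕ.< q → 0 ℕ.< p ℕ.* q
  *>0⁺ {suc _} {suc _} _ _ = ℕ.z<s

  *>0⁻ : ∀ p q → 0 ℕ.< p ℕ.* q → 0 ℕ.< p × 0 ℕ.< q
  *>0⁻ (suc _) (suc _) _ = ℕ.z<s , ℕ.z<s
  *>0⁻ (suc p) zero    h = contradiction (subst (0 ℕ.<_) (ℕ.*-zeroʳ p) h) (ℕ.<-irrefl refl)

  𝟏-refl : ∀ v → 0 ℕ.< (M ^ᴺ 0) v v
  𝟏-refl v with v Fin.≟ v
  ... | yes _  = ℕ.z<s
  ... | no v≢v = contradiction refl v≢v

  step⁺ : ∀ k {u v w} → 0 ℕ.< M u v → 0 ℕ.< (M ^ᴺ k) v w → 0 ℕ.< (M ^ᴺ suc k) u w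
  step⁺ k {u} {v} {w} p q = sum>0⁺ (λ z → M u z ℕ.* (M ^ᴺ k) z w) v (*>0⁺ p q)

  step⁻ : ∀ k {u w} → 0 ℕ.< (M ^ᴺ suc k) u w → ∃ λ v → 0 ℕ.< M u v × 0 ℕ.< (M ^ᴺ k) v w
  step⁻ k {u} {w} p =
    let (v , q) = sum>0⁻ (λ z → M u z ℕ.* (M ^ᴺ k) z w) p in v , *>0⁻ (M u v) ((M ^ᴺ k) v w) q

  compose : ∀ k l {u v w} → 0 ℕ.< (M ^ᴺ k) u v → 0 ℕ.< (M ^ᴺ l) v w →
            0 ℕ.< (M ^ᴺ (k ℕ.+ l)) u w
  compose zero l {u} {v} p q with u Fin.≟ v
  ... | yes refl = q
  compose zero l {u} {v} () q | no _
  compose (suc k) l p q =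
    let (_ , r , s) = step⁻ k p in step⁺ (k ℕ.+ l) r (compose k l s q)

  +∣j-i∣ : ∀ {i j} → i ℤ.≤ j → + ℤ.∣ j ℤ.- i ∣ ≡ j ℤ.- i
  +∣j-i∣ i≤j = ℤ.0≤i⇒+∣i∣≡i (ℤ.i≤j⇒0≤j-i i≤j)

  i+[j-i] : ∀ i j → i ℤ.+ (j ℤ.- i) ≡ j
  i+[j-i] i j = trans (cong (λ k → i ℤ.+ k) (ℤ.+-comm j (ℤ.- i)))
    (trans (sym (ℤ.+-assoc i (ℤ.- i) j))
      (trans (cong (ℤ._+ j) (ℤ.+-inverseʳ i)) (ℤ.+-identityˡ j)))

  i+k-i : ∀ i k → (i ℤ.+ k) ℤ.- i ≡ k
  i+k-i i k = trans (cong (ℤ._- i) (ℤ.+-comm i k))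
    (trans (ℤ.+-assoc k i (ℤ.- i)) (trans (cong (λ l → k ℤ.+ l) (ℤ.+-inverseʳ i)) (ℤ.+-identityʳ k)))

  level : ∀ {i j} → i ℤ.≤ j → j ≡ i ℤ.+ + ℤ.∣ j ℤ.- i ∣
  level {i} {j} i≤j = sym (trans (cong (λ k → i ℤ.+ k) (+∣j-i∣ i≤j)) (i+[j-i] i j))

  split : ∀ {i j k} → i ℤ.≤ j → j ℤ.≤ k →
          ℤ.∣ k ℤ.- i ∣ ≡ ℤ.∣ j ℤ.- i ∣ ℕ.+ ℤ.∣ k ℤ.- j ∣
  split {i} {j} {k} i≤j j≤k = ℤ.+-injective (trans (+∣j-i∣ (ℤ.≤-trans i≤j j≤k))
    (trans (cong (ℤ._- i) (trans (level j≤k) (trans (cong (ℤ._+ + ℤ.∣ k ℤ.- j ∣) (level i≤j))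
        (ℤ.+-assoc i (+ ℤ.∣ j ℤ.- i ∣) (+ ℤ.∣ k ℤ.- j ∣)))))
      (i+k-i i (+ ℤ.∣ j ℤ.- i ∣ ℤ.+ + ℤ.∣ k ℤ.- j ∣))))

  <-transitive : ∀ {x y z} → x < y → y < z → x < z
  <-transitive {u , i} {v , j} {w , k} (i<j , p) (j<k , q) =
    ℤ.<-trans i<j j<k ,
    subst (λ l → 0 ℕ.< (M ^ᴺ l) u w) (sym (split (ℤ.<⇒≤ i<j) (ℤ.<⇒≤ j<k)))
      (compose ℤ.∣ j ℤ.- i ∣ ℤ.∣ k ℤ.- j ∣ p q)

  ≤-level : ∀ {x y} → x ≤ y → proj₂ x ℤ.≤ proj₂ y
  ≤-level (inj₁ x<y)  = ℤ.<⇒≤ (proj₁ x<y)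
  ≤-level (inj₂ refl) = ℤ.≤-refl

  cover : ∀ {x y} → x < y → (∀ z → ¬ (x < z × z < y)) → proj₂ y ≡ ℤ.suc (proj₂ x)
  cover {u , i} {v , j} (i<j , p) none with ℤ.∣ j ℤ.- i ∣ in eq
  ... | zero = contradiction
    (trans (level (ℤ.<⇒≤ i<j)) (trans (cong (λ k → i ℤ.+ + k) eq) (ℤ.+-identityʳ i)))
    (λ j≡i → ℤ.<-irrefl (sym j≡i) i<j)
  ... | suc zero =
    trans (level (ℤ.<⇒≤ i<j)) (trans (cong (λ k → i ℤ.+ + k) eq) (ℤ.+-comm i (+ 1)))
  ... | suc (suc k) = contradiction (lower , upper) (none (w , i ℤ.+ + 1))
    where
    w = proj₁ (step⁻ (suc k) p)

    lower : (u , i) < (w , i ℤ.+ + 1)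
    lower = subst (ℤ._< i ℤ.+ + 1) (ℤ.+-identityʳ i) (ℤ.+-monoʳ-< i (ℤ.+<+ ℕ.z<s)) ,
      subst (λ l → 0 ℕ.< (M ^ᴺ l) u w) (sym (cong ℤ.∣_∣ (i+k-i i (+ 1))))
        (step⁺ 0 (proj₁ (proj₂ (step⁻ (suc k) p))) (𝟏-refl w))

    j≡ : j ≡ (i ℤ.+ + 1) ℤ.+ + suc k
    j≡ = trans (level (ℤ.<⇒≤ i<j)) (trans (cong (λ l → i ℤ.+ + l) eq)
      (sym (ℤ.+-assoc i (+ 1) (+ suc k))))

    upper : (w , i ℤ.+ + 1) < (v , j)
    upper =
      subst₂ ℤ._<_ (ℤ.+-identityʳ (i ℤ.+ + 1)) (sym j≡) (ℤ.+-monoʳ-< (i ℤ.+ + 1) (ℤ.+<+ ℕ.z<s)) ,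
      subst (λ l → 0 ℕ.< (M ^ᴺ l) w v)
        (sym (cong ℤ.∣_∣ (trans (cong (ℤ._- (i ℤ.+ + 1)) j≡) (i+k-i (i ℤ.+ + 1) (+ suc k)))))
        (proj₂ (proj₂ (step⁻ (suc k) p)))

  complete : ∀ {x y z} → x ≤ z → z ≤ y → z ∈ interval x y
  complete {x@(u , i)} {y@(v , j)} {z@(w , k)} x≤z z≤y =
    ∈-filter⁺ (λ z → x ≤? z ×-dec z ≤? y)
      (∈-cartesianProduct⁺ (∈-allFin w)
        (subst (_∈ levels) (sym (level i≤k)) (∈-map⁺ (λ l → i ℤ.+ + l) (∈-upTo⁺ (ℕ.s≤s below)))))
      (x≤z , z≤y)
    where
    levels = map (λ l → i ℤ.+ + l) (upTo (suc ℤ.∣ j ℤ.- i ∣))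
    i≤k = ≤-level x≤z
    below : ℤ.∣ k ℤ.- i ∣ ℕ.≤ ℤ.∣ j ℤ.- i ∣
    below = subst (ℤ.∣ k ℤ.- i ∣ ℕ.≤_) (sym (split i≤k (≤-level z≤y))) (ℕ.m≤m+n _ _)

  sound : ∀ {x y z} → z ∈ interval x y → x ≤ z × z ≤ y
  sound {x@(u , i)} {y@(v , j)} z∈ = proj₂ (∈-filter⁻ (λ z → x ≤? z ×-dec z ≤? y)
    {xs = cartesianProduct (allFin n) (map (λ k → i ℤ.+ + k) (upTo (suc ℤ.∣ j ℤ.- i ∣)))} z∈)

  unique : ∀ x y → Unique (interval x y)
  unique x@(u , i) y@(v , j) = Unique.filter⁺ (λ z → x ≤? z ×-dec z ≤? y)
    (Unique.cartesianProduct⁺ (Unique.allFin⁺ n)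
      (Unique.map⁺ (λ {k} {l} eq → ℤ.+-injective
        (trans (sym (i+k-i i (+ k))) (trans (cong (ℤ._- i) eq) (i+k-i i (+ l))))) (Unique.upTo⁺ _)))

  levelPoset : LocallyFiniteGradedPoset
  levelPoset = record
    { Carrier              = Fin n × ℤ
    ; _<_                  = _<_
    ; isStrictPartialOrder = record
      { isEquivalence = isEquivalence
      ; irrefl        = λ { refl (i<i , _) → ℤ.<-irrefl refl i<i }
      ; trans         = <-transitive
      ; <-resp-≈      = (λ { refl x<y → x<y }) , (λ { refl x<y → x<y })
      }
    ; _≟_                  = _≟_
    ; _<?_                 = _<?_
    ; ρ                    = proj₂
    ; ρ-strictlyMonotone   = proj₁
    ; ρ-cover              = cover
    ; interval             = interval
    ; ∈-interval⁺          = complete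
    ; ∈-interval⁻          = sound
    ; interval-unique      = unique
    }

open LevelPoset public using (levelPoset)

module NoncommutativeSeries {c ℓ} (R : CommutativeRing c ℓ) where

  private module R = CommutativeRing R

  -- R⟨⟨x₀, …, x_{q-1}⟩⟩: a series is given by its coefficient at each word
  Series : ℕ → Set c
  Series q = List (Fin q) → R.Carrier

  infix 4 _≈_
  _≈_ : ∀ {q} → Series q → Series q → Set ℓ
  f ≈ g = ∀ w → f w R.≈ g w

  Σ[_] : List R.Carrier → R.Carrier
  Σ[_] = foldr R._+_ R.0#

  splits : ∀ {a} {A : Set a} → List A → List (List A × List A)
  splits []      = [ [] , [] ]
  splits (x ∷ w) = ([] , x ∷ w) ∷ map (map₁ (x ∷_)) (splits w)

  monomial : ∀ {q} → List (Fin q) → Series q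
  monomial v w = if does (List.≡-dec Fin._≟_ w v) then R.1# else R.0#

  seriesRawRing : ℕ → RawRing c ℓ
  seriesRawRing q = record
    { Carrier = Series q
    ; _≈_     = _≈_
    ; _+_     = λ f g w → f w R.+ g w
    ; _*_     = λ f g w → Σ[ map (λ (u , v) → f u R.* g v) (splits w) ]
    ; -_      = λ f w → R.- f w
    ; 0#      = λ _ → R.0#
    ; 1#      = monomial []
    }

  module _ {q : ℕ} where
    open RawRing (seriesRawRing q) public using (_+_; _*_; -_; 0#; 1#)
    open RawSemiringDefinitions (RawRing.rawSemiring (seriesRawRing q)) public
      using (_^_) renaming (_×_ to _⨯_)
    open MatrixOperations (RawRing.rawSemiring (seriesRawRing q)) public using (_·_)

  infixl 6 _-_
  _-_ : ∀ {q} → Series q → Series q → Series q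
  f - g = f + (- g)

  var : ∀ {q} → Fin q → Series q
  var x = monomial [ x ]

  -- f₀ + f₁ + f₂ + ⋯, provided f m has no terms of degree less than m: then
  -- only f₀, …, f_{|w|} contribute to the coefficient at w
  Σ∞ : ∀ {q} → (ℕ → Series q) → Series q
  Σ∞ f w = Σ[ map (λ m → f m w) (upTo (suc (length w))) ]

  -- The linear extension Σᵥ f(v) v ↦ Σᵥ f(v) φ(v), degree by degree, of a map φ
  -- on words for which φ(v) is homogeneous of degree |v|: then only the words v
  -- with |v| = |w| contribute to the coefficient at w
  extend : ∀ {p q} → (List (Fin p) → Series q) → Series p → Series q
  extend {p} φ f w = Σ[ map (λ v → f v R.* φ v w) (tuples (allFin p) (length w)) ]

  -- the substitution homomorphism xᵢ ↦ σ i, for σ i homogeneous of degree one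
  substitute : ∀ {p q} → (Fin p → Series q) → Series p → Series q
  substitute σ = extend (λ v → foldr _*_ 1# (map σ v))

  𝐚 𝐛 : ∀ {q} → Series (2 ℕ.+ q)
  𝐚 = var 0F
  𝐛 = var 1F

  𝐭 : Series 3
  𝐭 = var 2F

  t : Series 1
  t = var 0F

  -- the inclusion R⟨⟨𝐚,𝐛⟩⟩ ⊆ R⟨⟨𝐚,𝐛,𝐭⟩⟩
  ι : Series 2 → Series 3
  ι = extend (λ v → monomial (map inject₁ v))

  -- Δ(1) = 0 and Δ(x v) = Δ(x) v + x Δ(v), where Δ(𝐚) = Δ(𝐛) = 𝐭
  Δ-word : List (Fin 2) → Series 3
  Δ-word []      = 0#
  Δ-word (x ∷ v) = 𝐭 * monomial (map inject₁ v) + var (inject₁ x) * Δ-word v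

  Δ : Series 2 → Series 3
  Δ = extend Δ-word

  _∣𝐚=t,𝐛=0 : Series 2 → Series 1
  _∣𝐚=t,𝐛=0 = substitute (λ { 0F → t ; 1F → 0# })

  module ABIndex (P : LocallyFiniteGradedPoset) where

    open LocallyFiniteGradedPoset P using (Carrier; rank; chains)

    wt : Carrier → List Carrier → Carrier → Series 2
    wt x []      y = (𝐚 - 𝐛) ^ (rank x y ∸ 1)
    wt x (z ∷ c) y = (𝐚 - 𝐛) ^ (rank x z ∸ 1) * (𝐛 * wt z c y)

    -- the 𝐚𝐛-index of the interval [x , y], for x < y
    Ψ[_,_] : Carrier → Carrier → Series 2
    Ψ[ x , y ] = foldr _+_ 0# (map (λ c → wt x c y) (chains x y))

  module _ {n : ℕ} (M : Matrix ℕ n) where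

    open LocallyFiniteGradedPoset (levelPoset M) using (_≤?_)
    open ABIndex (levelPoset M)

    abSeries : Matrix (Series 2) n
    abSeries x y = Σ∞ λ m →
      if does ((x , + 0) ≤? (y , + suc m)) then Ψ[ (x , + 0) , (y , + suc m) ] else 0#

    Kcoefficient : ℕ → Matrix ℕ n
    Kcoefficient zero    = M
    Kcoefficient (suc m) = Bin (M ^ᴺ (2 ℕ.+ m))

    K : Matrix (Series 1) n
    K x y = Σ∞ λ m → (Kcoefficient m x y ⨯ 1#) * t ^ m

  infix 4 _≈ₘ_
  _≈ₘ_ : ∀ {q n} → Matrix (Series q) n → Matrix (Series q) n → Set ℓ
  A ≈ₘ B = ∀ x y → A x y ≈ B x y

  SatisfiesSystem : ∀ {n} → Matrix ℕ n → Matrix (Series 2) n → Set ℓ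
  SatisfiesSystem M Φ =
    (λ x y → Φ x y ∣𝐚=t,𝐛=0) ≈ₘ K M ×
    (λ x y → Δ (Φ x y)) ≈ₘ (λ x y → ι (Φ x y) * 𝐭) · (λ x y → ι (Φ x y))

open RealNumbers using (ℝ; ℝ-commutativeRing) public
open NoncommutativeSeries ℝ-commutativeRing public

{-# OPTIONS --safe #-}
module Submission where

-- The relation is overdetermined: a word with several letters 𝐛 can be split at any of them. `G`
-- splits only at the first one, and its agreement with every other splitting comes down to
-- associativity of the matrix product. Words are read from the left, so the letters already read
-- are lost. All that is kept of them is the family `c`, which is why the statements about `G` hold
-- for arbitrary `c` and not only for `κ`. The two sides meet because one 0/1 matrix, `κ j`, is both
-- the coefficient of tʲ in K(t) and the indicator of the order between levels at distance j + 1. On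
-- the poset side the invariant is level plus word length: for chains from level i up to level m + 1
-- only words with i + |w| = m matter, and each link of a chain preserves this sum. Comparing with
-- `G` at every level at once avoids any argument that intervals are invariant under shifting
-- levels.

-- Write Φ w for the coefficient matrix of Φ at a word w.  Only words u 𝐭 v with u, v in 𝐚, 𝐛 matter in the
-- second equation, so the system says Φ(𝐚ᵏ) = κ k, the coefficient of tᵏ in K(t), and
--   Φ(u 𝐚 v) + Φ(u 𝐛 v) = Φ(u) Φ(v).
-- Solving for Φ(u 𝐛 v), with u a power of 𝐚, determines Φ recursively; the matrix G so obtained satisfies the
-- relation for every u by induction on u.  On the other side, splitting a chain at its least inner element gives
--   Ψ = Σ κ_j (𝐚 - 𝐛)ʲ + Σ κ_j (𝐚 - 𝐛)ʲ 𝐛 Ψ,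
-- and reading off the coefficient at a word one letter at a time turns this into the recursion of G.

open import Defs using
  (Matrix; tuples; IsBinary; _^ᴺ_; levelPoset; module LevelPoset; module NoncommutativeSeries;
   LocallyFiniteGradedPoset)
open import Algebra.Bundles using (CommutativeRing; RawRing)
import Algebra.Properties.CommutativeSemigroup as CommutativeSemigroupProperties
import Algebra.Properties.Ring as RingProperties
import Algebra.Properties.Semiring.Sum as SemiringSum
import Algebra.Definitions.RawSemiring as RawSemiringDefinitions
open import Data.Bool.Base using (true; false; if_then_else_; _∧_)
open import Data.Fin.Base using (Fin; inject₁)
open import Data.Fin.Patterns using (0F; 1F; 2F)
import Data.Fin.Properties as Fin
open import Data.Integer.Base as ℤ using (ℤ) renaming (+_ to pos)
import Data.Integer.Properties as ℤ
open import Data.List.Base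
  using (List; []; _∷_; _++_; [_]; map; filter; foldr; concatMap; length; upTo; applyUpTo; allFin; tabulate;
         replicate; cartesianProduct; cartesianProductWith)
import Data.List.Properties as List
open import Data.List.Relation.Unary.All as All using ()
open import Data.List.Relation.Unary.Linked using (Linked; linked?; _∷_)
open import Data.Nat.Base as ℕ using (ℕ; zero; suc; NonZero; _∸_)
import Data.Nat.Properties as ℕ
open import Data.Product.Base using (∃; _×_; _,_; proj₁)
open import Data.Sum.Base using (_⊎_; inj₁; inj₂)
open import Function.Base using (_∘_; id)
open import Relation.Binary.PropositionalEquality as ≡ using (_≡_; _≢_)
import Relation.Binary.Reasoning.Setoid as SetoidReasoning
open import Relation.Nullary.Decidable using (Dec; does; yes; no; _×-dec_; dec-true; dec-false)
open import Relation.Nullary.Negation using (¬_; contradiction)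

module Coefficients {c ℓ} (R : CommutativeRing c ℓ) where

  open CommutativeRing R
  open RingProperties ring using (-0#≈0#; -‿+-comm; -‿distribˡ-*; -‿distribʳ-*; x≈z//y)
  open CommutativeSemigroupProperties +-commutativeSemigroup using (interchange)
  open SemiringSum semiring using
    (sum; sum-cong-≋; sum-replicate-zero; ∑-distrib-+; ∑-comm; *-distribˡ-sum; *-distribʳ-sum)
  open SetoidReasoning setoid
  open NoncommutativeSeries R
    renaming (_+_ to _⊕_; _*_ to _⊛_; -_ to ⊝_; _-_ to _⊖_; 0# to 𝟘; 1# to 𝟙; _^_ to _↑_; _≈_ to _≋_)

  -- Indicators of decidable propositions

  ⟦_⟧ : ∀ {a} {A : Set a} → Dec A → Carrier
  ⟦ d ⟧ = if does d then 1# else 0#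

  ⟦⟧-yes : ∀ {a} {A : Set a} (d : Dec A) → A → ⟦ d ⟧ ≡ 1#
  ⟦⟧-yes d p = ≡.cong (if_then 1# else 0#) (dec-true d p)

  ⟦⟧-*-cong : ∀ {a} {A : Set a} (d : Dec A) {x y} → (A → x ≈ y) → ⟦ d ⟧ * x ≈ ⟦ d ⟧ * y
  ⟦⟧-*-cong (yes p) x≈y = *-congˡ (x≈y p)
  ⟦⟧-*-cong (no ¬p) x≈y = trans (zeroˡ _) (sym (zeroˡ _))

  ⟦⟧-*-zero : ∀ {a} {A : Set a} (d : Dec A) {x} → (A → x ≈ 0#) → ⟦ d ⟧ * x ≈ 0#
  ⟦⟧-*-zero d x≈0 = trans (⟦⟧-*-cong d x≈0) (zeroʳ _)

  -- Stated for Booleans because `does (linked? ...)` on a list of two or more elements computes to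
  -- a conjunction, so the condition on the first link of a chain splits off directly.
  ⟦⟧-×-* : ∀ b b′ x → (if b ∧ b′ then 1# else 0#) * x ≈ (if b then 1# else 0#) * ((if b′ then 1# else 0#) * x)
  ⟦⟧-×-* true  b′ x = sym (*-identityˡ _)
  ⟦⟧-×-* false b′ x = trans (zeroˡ x) (sym (zeroˡ _))

  -- Finite sums over lists

  module _ {a} {A : Set a} where

    Σ-cong : ∀ {f g : A → Carrier} → (∀ x → f x ≈ g x) → ∀ xs → Σ[ map f xs ] ≈ Σ[ map g xs ]
    Σ-cong f≈g []       = refl
    Σ-cong f≈g (x ∷ xs) = +-cong (f≈g x) (Σ-cong f≈g xs)

    Σ-zero : ∀ {f : A → Carrier} → (∀ x → f x ≈ 0#) → ∀ xs → Σ[ map f xs ] ≈ 0#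
    Σ-zero f≈0 []       = refl
    Σ-zero f≈0 (x ∷ xs) = trans (+-cong (f≈0 x) (Σ-zero f≈0 xs)) (+-identityˡ 0#)

    Σ-+ : ∀ (f g : A → Carrier) xs → Σ[ map (λ x → f x + g x) xs ] ≈ Σ[ map f xs ] + Σ[ map g xs ]
    Σ-+ f g []       = sym (+-identityˡ 0#)
    Σ-+ f g (x ∷ xs) = trans (+-congˡ (Σ-+ f g xs)) (interchange _ _ _ _)

    Σ-neg : ∀ (f : A → Carrier) xs → Σ[ map (λ x → - f x) xs ] ≈ - Σ[ map f xs ]
    Σ-neg f []       = sym -0#≈0#
    Σ-neg f (x ∷ xs) = trans (+-congˡ (Σ-neg f xs)) (-‿+-comm _ _)

    *-Σ : ∀ r (f : A → Carrier) xs → r * Σ[ map f xs ] ≈ Σ[ map (λ x → r * f x) xs ]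
    *-Σ r f []       = zeroʳ r
    *-Σ r f (x ∷ xs) = trans (distribˡ r _ _) (+-congˡ (*-Σ r f xs))

    Σ-++ : ∀ (f : A → Carrier) xs ys → Σ[ map f (xs ++ ys) ] ≈ Σ[ map f xs ] + Σ[ map f ys ]
    Σ-++ f []       ys = sym (+-identityˡ _)
    Σ-++ f (x ∷ xs) ys = trans (+-congˡ (Σ-++ f xs ys)) (sym (+-assoc _ _ _))

    Σ-filter : ∀ {p} {P : A → Set p} (P? : ∀ x → Dec (P x)) (f : A → Carrier) xs →
               Σ[ map f (filter P? xs) ] ≈ Σ[ map (λ x → ⟦ P? x ⟧ * f x) xs ]
    Σ-filter P? f []       = refl
    Σ-filter P? f (x ∷ xs) with does (P? x)
    ... | true  = +-cong (sym (*-identityˡ _)) (Σ-filter P? f xs)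
    ... | false = trans (Σ-filter P? f xs) (sym (trans (+-congʳ (zeroˡ _)) (+-identityˡ _)))

  module _ {a b} {A : Set a} {B : Set b} where

    Σ-concatMap : ∀ (f : B → Carrier) (g : A → List B) xs →
                  Σ[ map f (concatMap g xs) ] ≈ Σ[ map (λ x → Σ[ map f (g x) ]) xs ]
    Σ-concatMap f g []       = refl
    Σ-concatMap f g (x ∷ xs) = trans (Σ-++ f (g x) (concatMap g xs)) (+-congˡ (Σ-concatMap f g xs))

    Σ-swap : ∀ (f : A → B → Carrier) xs ys →
             Σ[ map (λ x → Σ[ map (f x) ys ]) xs ] ≈ Σ[ map (λ y → Σ[ map (λ x → f x y) xs ]) ys ]
    Σ-swap f []       ys = sym (Σ-zero (λ _ → refl) ys)
    Σ-swap f (x ∷ xs) ys = trans (+-congˡ (Σ-swap f xs ys)) (sym (Σ-+ (f x) (λ y → Σ[ map (λ x → f x y) xs ]) ys))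

    Σ-cartesianProductWith : ∀ {c} {C : Set c} (f : C → Carrier) (_·_ : A → B → C) xs ys →
      Σ[ map f (cartesianProductWith _·_ xs ys) ] ≈ Σ[ map (λ x → Σ[ map (λ y → f (x · y)) ys ]) xs ]
    Σ-cartesianProductWith f _·_ []       ys = refl
    Σ-cartesianProductWith f _·_ (x ∷ xs) ys = trans
      (Σ-++ f (map (x ·_) ys) (cartesianProductWith _·_ xs ys))
      (+-cong (reflexive (≡.cong Σ[_] (≡.sym (List.map-∘ ys)))) (Σ-cartesianProductWith f _·_ xs ys))

  Σ-tabulate : ∀ {a} {A : Set a} {n} (f : A → Carrier) (g : Fin n → A) → Σ[ map f (tabulate g) ] ≈ sum (f ∘ g)
  Σ-tabulate {n = zero}  f g = refl
  Σ-tabulate {n = suc n} f g = +-congˡ (Σ-tabulate f (g ∘ Fin.suc))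

  sum-zero : ∀ {n} (f : Fin n → Carrier) → (∀ x → f x ≈ 0#) → sum f ≈ 0#
  sum-zero {n} f f≈0 = trans (sum-cong-≋ f≈0) (sum-replicate-zero n)

  sum-neg : ∀ {n} (f : Fin n → Carrier) → sum (λ x → - f x) ≈ - sum f
  sum-neg {zero}  f = sym -0#≈0#
  sum-neg {suc n} f = trans (+-congˡ (sum-neg (f ∘ Fin.suc))) (-‿+-comm _ _)

  Σ< : ℕ → (ℕ → Carrier) → Carrier
  Σ< n f = Σ[ applyUpTo f n ]

  Σ<-cong : ∀ n {f g : ℕ → Carrier} → (∀ k → k ℕ.< n → f k ≈ g k) → Σ< n f ≈ Σ< n g
  Σ<-cong zero    f≈g = refl
  Σ<-cong (suc n) f≈g = +-cong (f≈g 0 ℕ.z<s) (Σ<-cong n (λ k k<n → f≈g (suc k) (ℕ.s<s k<n)))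

  Σ<-zero : ∀ n {f : ℕ → Carrier} → (∀ k → f k ≈ 0#) → Σ< n f ≈ 0#
  Σ<-zero zero    f≈0 = refl
  Σ<-zero (suc n) f≈0 = trans (+-cong (f≈0 0) (Σ<-zero n (f≈0 ∘ suc))) (+-identityˡ 0#)

  Σ<-neg : ∀ n (f : ℕ → Carrier) → Σ< n (λ k → - f k) ≈ - Σ< n f
  Σ<-neg zero    f = sym -0#≈0#
  Σ<-neg (suc n) f = trans (+-congˡ (Σ<-neg n (f ∘ suc))) (-‿+-comm _ _)

  Σ<-drop : ∀ i n (f : ℕ → Carrier) → (∀ k → k ℕ.< i → f k ≈ 0#) → Σ< (i ℕ.+ n) f ≈ Σ< n (λ j → f (i ℕ.+ j))
  Σ<-drop zero    n f f≈0 = refl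
  Σ<-drop (suc i) n f f≈0 = trans (+-congʳ (f≈0 0 ℕ.z<s))
    (trans (+-identityˡ _) (Σ<-drop i n (f ∘ suc) (λ k k<i → f≈0 (suc k) (ℕ.s<s k<i))))

  Σ<-last : ∀ n (f : ℕ → Carrier) → (∀ k → k ≢ n → f k ≈ 0#) → Σ< (suc n) f ≈ f n
  Σ<-last zero    f f≈0 = +-identityʳ (f 0)
  Σ<-last (suc n) f f≈0 = trans (+-congʳ (f≈0 0 (λ ())))
    (trans (+-identityˡ _) (Σ<-last n (f ∘ suc) (λ k k≢n → f≈0 (suc k) (k≢n ∘ ℕ.suc-injective))))

  -- `Σ∞` is cut off after m = |w|, so under this hypothesis only its last summand survives.
  Σ∞-homogeneous : ∀ {q} (f : ℕ → Series q) w → (∀ m → m ≢ length w → f m w ≈ 0#) → Σ∞ f w ≈ f (length w) w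
  Σ∞-homogeneous f w f≈0 = trans
    (reflexive (≡.cong Σ[_] (List.map-upTo (λ m → f m w) (suc (length w)))))
    (Σ<-last (length w) (λ m → f m w) f≈0)

  -- Products of series, one letter at a time

  -- The left quotient by a letter (Brzozowski derivative). Its product rule `⊛-∷` turns statements
  -- about convolutions into inductions along the word, without first making the series into a ring.
  ∂ : ∀ {q} → Fin q → Series q → Series q
  ∂ x f w = f (x ∷ w)

  module _ {q : ℕ} where

    ⊛-[] : (f g : Series q) → (f ⊛ g) [] ≈ f [] * g []
    ⊛-[] f g = +-identityʳ _

    ⊛-∷ : ∀ (f g : Series q) x w → (f ⊛ g) (x ∷ w) ≈ f [] * g (x ∷ w) + (∂ x f ⊛ g) w
    ⊛-∷ f g x w = +-congˡ (reflexive (≡.cong Σ[_] (≡.sym (List.map-∘ (splits w)))))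

    ⊛-congʳ : ∀ {f f′ : Series q} g → f ≋ f′ → f ⊛ g ≋ f′ ⊛ g
    ⊛-congʳ g f≋f′ w = Σ-cong (λ (u , v) → *-congʳ (f≋f′ u)) (splits w)

    𝟘-⊛ : ∀ {f : Series q} g → f ≋ 𝟘 → f ⊛ g ≋ 𝟘
    𝟘-⊛ g f≋0 w = Σ-zero (λ (u , v) → trans (*-congʳ (f≋0 u)) (zeroˡ _)) (splits w)

    ⊝-⊛ : ∀ (f g : Series q) → (⊝ f) ⊛ g ≋ ⊝ (f ⊛ g)
    ⊝-⊛ f g w = trans (Σ-cong (λ (u , v) → sym (-‿distribˡ-* (f u) (g v))) (splits w)) (Σ-neg _ (splits w))

    𝟙-⊛ : ∀ {f : Series q} g → f ≋ 𝟙 → f ⊛ g ≋ g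
    𝟙-⊛ {f} g f≋1 []      = trans (⊛-[] f g) (trans (*-congʳ (f≋1 [])) (*-identityˡ _))
    𝟙-⊛ {f} g f≋1 (x ∷ w) = trans (⊛-∷ f g x w)
      (trans (+-cong (trans (*-congʳ (f≋1 [])) (*-identityˡ _)) (𝟘-⊛ g (f≋1 ∘ (x ∷_)) w)) (+-identityʳ _))

    ⊛-[]-const : ∀ (f : Series q) g → f [] ≈ 0# → (f ⊛ g) [] ≈ 0#
    ⊛-[]-const f g f[]≈0 = trans (⊛-[] f g) (trans (*-congʳ f[]≈0) (zeroˡ _))

    ⊛-∷-const : ∀ (f : Series q) g x w → f [] ≈ 0# → (f ⊛ g) (x ∷ w) ≈ (∂ x f ⊛ g) w
    ⊛-∷-const f g x w f[]≈0 = trans (⊛-∷ f g x w) (trans (+-congʳ (trans (*-congʳ f[]≈0) (zeroˡ _))) (+-identityˡ _))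

    var-⊛-[] : ∀ x (f : Series q) → (var x ⊛ f) [] ≈ 0#
    var-⊛-[] x f = ⊛-[]-const (var x) f refl

    var-⊛-∷ : ∀ x (f : Series q) y w → (var x ⊛ f) (y ∷ w) ≈ (if does (y Fin.≟ x) then f w else 0#)
    var-⊛-∷ x f y w = trans (⊛-∷-const (var x) f y w refl) (decide (does (y Fin.≟ x)))
      where
      decide : ∀ b → ((λ u → if b ∧ does (List.≡-dec Fin._≟_ u []) then 1# else 0#) ⊛ f) w ≈ (if b then f w else 0#)
      decide true  = 𝟙-⊛ f (λ _ → refl) w
      decide false = 𝟘-⊛ f (λ _ → refl) w

  -- The two equations in terms of coefficients

  extend-∷ : ∀ {q} (φ φ₀ φ₁ : List (Fin 2) → Series q) f x w →
             (∀ v → φ (0F ∷ v) (x ∷ w) ≈ φ₀ v w) → (∀ v → φ (1F ∷ v) (x ∷ w) ≈ φ₁ v w) →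
             extend φ f (x ∷ w) ≈ extend φ₀ (∂ 0F f) w + extend φ₁ (∂ 1F f) w
  extend-∷ φ φ₀ φ₁ f x w φ≈φ₀ φ≈φ₁ = trans
    (Σ-cartesianProductWith (λ v → f v * φ v (x ∷ w)) _∷_ (allFin 2) (tuples (allFin 2) (length w)))
    (trans (+-congˡ (+-identityʳ _)) (+-cong
      (Σ-cong (λ v → *-congˡ (φ≈φ₀ v)) (tuples (allFin 2) (length w)))
      (Σ-cong (λ v → *-congˡ (φ≈φ₁ v)) (tuples (allFin 2) (length w)))))

  extend-𝟘 : ∀ {q} f (w : List (Fin q)) → extend {2} (λ _ → 𝟘) f w ≈ 0#
  extend-𝟘 f w = Σ-zero (λ v → zeroʳ _) (tuples (allFin 2) (length w))

  extend-∷-𝐚 : ∀ {q} (φ φ₀ : List (Fin 2) → Series q) f x w →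
               (∀ v → φ (0F ∷ v) (x ∷ w) ≈ φ₀ v w) → (∀ v → φ (1F ∷ v) (x ∷ w) ≈ 0#) →
               extend φ f (x ∷ w) ≈ extend φ₀ (∂ 0F f) w
  extend-∷-𝐚 φ φ₀ f x w φ≈φ₀ φ≈0 = trans (extend-∷ φ φ₀ (λ _ → 𝟘) f x w φ≈φ₀ φ≈0)
    (trans (+-congˡ (extend-𝟘 (∂ 1F f) w)) (+-identityʳ _))

  extend-∷-𝐛 : ∀ {q} (φ φ₁ : List (Fin 2) → Series q) f x w →
               (∀ v → φ (0F ∷ v) (x ∷ w) ≈ 0#) → (∀ v → φ (1F ∷ v) (x ∷ w) ≈ φ₁ v w) →
               extend φ f (x ∷ w) ≈ extend φ₁ (∂ 1F f) w
  extend-∷-𝐛 φ φ₁ f x w φ≈0 φ≈φ₁ = trans (extend-∷ φ (λ _ → 𝟘) φ₁ f x w φ≈0 φ≈φ₁)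
    (trans (+-congʳ (extend-𝟘 (∂ 0F f) w)) (+-identityˡ _))

  module Substitution (σ : Fin 2 → Series 1) (σ0≡t : σ 0F ≡ t) (σ1≡0 : σ 1F ≡ 𝟘) where

    σ-word : List (Fin 2) → Series 1
    σ-word v = foldr _⊛_ 𝟙 (map σ v)

    substitute-coefficient : ∀ f w → substitute σ f w ≈ f (replicate (length w) 0F)
    substitute-coefficient f []       = trans (+-identityʳ _) (*-identityʳ _)
    substitute-coefficient f (0F ∷ w) = trans
      (extend-∷-𝐚 σ-word σ-word f 0F w
        (λ v → trans (reflexive (≡.cong (λ g → (g ⊛ σ-word v) (0F ∷ w)) σ0≡t)) (var-⊛-∷ 0F (σ-word v) 0F w))
        (λ v → 𝟘-⊛ (σ-word v) (λ u → reflexive (≡.cong (λ g → g u) σ1≡0)) (0F ∷ w)))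
      (substitute-coefficient (∂ 0F f) w)

  𝐚=t,𝐛=0-coefficient : ∀ f w → (f ∣𝐚=t,𝐛=0) w ≈ f (replicate (length w) 0F)
  -- The substitution is a pattern-matching lambda, which cannot be written again so as to be the
  -- same term. Unification supplies it, and the two values it takes are passed as equations.
  𝐚=t,𝐛=0-coefficient = Substitution.substitute-coefficient _ ≡.refl ≡.refl

  ι-word : List (Fin 2) → Series 3
  ι-word v = monomial (map inject₁ v)

  ι-[] : ∀ f → ι f [] ≈ f []
  ι-[] f = trans (+-identityʳ _) (*-identityʳ _)

  ι-𝐚 : ∀ f w → ι f (0F ∷ w) ≈ ι (∂ 0F f) w
  ι-𝐚 f w = extend-∷-𝐚 ι-word ι-word f 0F w (λ _ → refl) (λ _ → refl)

  ι-𝐛 : ∀ f w → ι f (1F ∷ w) ≈ ι (∂ 1F f) w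
  ι-𝐛 f w = extend-∷-𝐛 ι-word ι-word f 1F w (λ _ → refl) (λ _ → refl)

  ι-𝐭 : ∀ f w → ι f (2F ∷ w) ≈ 0#
  ι-𝐭 f w = trans (extend-∷-𝐚 ι-word (λ _ → 𝟘) f 2F w (λ _ → refl) (λ _ → refl)) (extend-𝟘 (∂ 0F f) w)

  ι-inject₁ : ∀ f v → ι f (map inject₁ v) ≈ f v
  ι-inject₁ f []       = ι-[] f
  ι-inject₁ f (0F ∷ v) = trans (ι-𝐚 f (map inject₁ v)) (ι-inject₁ (∂ 0F f) v)
  ι-inject₁ f (1F ∷ v) = trans (ι-𝐛 f (map inject₁ v)) (ι-inject₁ (∂ 1F f) v)

  -- Either w is free of 𝐭 or it is not. The second case quantifies over f so that one decision
  -- about w serves all the series occurring on both sides of the equation.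
  ι-support : ∀ w → (∃ λ v → w ≡ map inject₁ v) ⊎ (∀ f → ι f w ≈ 0#)
  ι-support []       = inj₁ ([] , ≡.refl)
  ι-support (2F ∷ w) = inj₂ (λ f → ι-𝐭 f w)
  ι-support (0F ∷ w) with ι-support w
  ... | inj₁ (v , eq) = inj₁ (0F ∷ v , ≡.cong (0F ∷_) eq)
  ... | inj₂ ι≈0      = inj₂ (λ f → trans (ι-𝐚 f w) (ι≈0 (∂ 0F f)))
  ι-support (1F ∷ w) with ι-support w
  ... | inj₁ (v , eq) = inj₁ (1F ∷ v , ≡.cong (1F ∷_) eq)
  ... | inj₂ ι≈0      = inj₂ (λ f → trans (ι-𝐛 f w) (ι≈0 (∂ 1F f)))

  Δ-[] : ∀ f → Δ f [] ≈ 0#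
  Δ-[] f = trans (+-identityʳ _) (zeroʳ _)

  Δ-word-∷ : ∀ x v y w → Δ-word (x ∷ v) (y ∷ w) ≈
             (if does (y Fin.≟ 2F) then ι-word v w else 0#) + (if does (y Fin.≟ inject₁ x) then Δ-word v w else 0#)
  Δ-word-∷ x v y w = +-cong (var-⊛-∷ 2F (ι-word v) y w) (var-⊛-∷ (inject₁ x) (Δ-word v) y w)

  Δ-𝐚 : ∀ f w → Δ f (0F ∷ w) ≈ Δ (∂ 0F f) w
  Δ-𝐚 f w = extend-∷-𝐚 Δ-word Δ-word f 0F w
    (λ v → trans (Δ-word-∷ 0F v 0F w) (+-identityˡ _)) (λ v → trans (Δ-word-∷ 1F v 0F w) (+-identityˡ _))

  Δ-𝐛 : ∀ f w → Δ f (1F ∷ w) ≈ Δ (∂ 1F f) w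
  Δ-𝐛 f w = extend-∷-𝐛 Δ-word Δ-word f 1F w
    (λ v → trans (Δ-word-∷ 0F v 1F w) (+-identityˡ _)) (λ v → trans (Δ-word-∷ 1F v 1F w) (+-identityˡ _))

  Δ-𝐭 : ∀ f w → Δ f (2F ∷ w) ≈ ι (∂ 0F f) w + ι (∂ 1F f) w
  Δ-𝐭 f w = extend-∷ Δ-word ι-word ι-word f 2F w
    (λ v → trans (Δ-word-∷ 0F v 2F w) (+-identityʳ _)) (λ v → trans (Δ-word-∷ 1F v 2F w) (+-identityʳ _))

  ⟨_𝐭_⟩ : Series 2 → Series 2 → Series 3
  ⟨ g 𝐭 h ⟩ = (ι g ⊛ 𝐭) ⊛ ι h

  ι⊛𝐭-[] : ∀ g → (ι g ⊛ 𝐭) [] ≈ 0#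
  ι⊛𝐭-[] g = trans (⊛-[] (ι g) 𝐭) (zeroʳ _)

  𝐭-product-[] : ∀ g h → ⟨ g 𝐭 h ⟩ [] ≈ 0#
  𝐭-product-[] g h = ⊛-[]-const (ι g ⊛ 𝐭) (ι h) (ι⊛𝐭-[] g)

  -- A letter read before 𝐭 can only come from the first factor. The two hypotheses treat 𝐚 and 𝐛
  -- together.
  𝐭-product-letter : ∀ (x : Fin 2) g h w →
                     (∀ u → ι g (inject₁ x ∷ u) ≈ ι (∂ x g) u) → (∀ u → 𝐭 (inject₁ x ∷ u) ≈ 0#) →
                     ⟨ g 𝐭 h ⟩ (inject₁ x ∷ w) ≈ ⟨ ∂ x g 𝐭 h ⟩ w
  𝐭-product-letter x g h w ∂ι ∂𝐭≈0 = trans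
    (⊛-∷-const (ι g ⊛ 𝐭) (ι h) (inject₁ x) w (ι⊛𝐭-[] g))
    (⊛-congʳ (ι h) (λ u → trans (⊛-∷ (ι g) 𝐭 (inject₁ x) u)
      (trans (+-cong (trans (*-congˡ (∂𝐭≈0 u)) (zeroʳ _)) (⊛-congʳ 𝐭 ∂ι u)) (+-identityˡ _))) w)

  𝐭-product-𝐚 : ∀ g h w → ⟨ g 𝐭 h ⟩ (0F ∷ w) ≈ ⟨ ∂ 0F g 𝐭 h ⟩ w
  𝐭-product-𝐚 g h w = 𝐭-product-letter 0F g h w (ι-𝐚 g) (λ u → refl)

  𝐭-product-𝐛 : ∀ g h w → ⟨ g 𝐭 h ⟩ (1F ∷ w) ≈ ⟨ ∂ 1F g 𝐭 h ⟩ w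
  𝐭-product-𝐛 g h w = 𝐭-product-letter 1F g h w (ι-𝐛 g) (λ u → refl)

  𝐭-product-𝐭 : ∀ g h w → ⟨ g 𝐭 h ⟩ (2F ∷ w) ≈ g [] * ι h w
  𝐭-product-𝐭 g h w = begin
    ⟨ g 𝐭 h ⟩ (2F ∷ w)              ≈⟨ ⊛-∷-const (ι g ⊛ 𝐭) (ι h) 2F w (ι⊛𝐭-[] g) ⟩
    (∂ 2F (ι g ⊛ 𝐭) ⊛ ι h) w        ≈⟨ ⊛-congʳ (ι h) (λ u → trans (⊛-∷ (ι g) 𝐭 2F u)
                                         (trans (+-cong (*-congʳ (ι-[] g)) (𝟘-⊛ 𝐭 (ι-𝐭 g) u)) (+-identityʳ _))) w ⟩
    ((λ u → g [] * 𝟙 u) ⊛ ι h) w    ≈⟨ Σ-cong (λ _ → *-assoc _ _ _) (splits w) ⟩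
    _                                ≈⟨ *-Σ (g []) _ (splits w) ⟨
    g [] * (𝟙 ⊛ ι h) w              ≈⟨ *-congˡ (𝟙-⊛ (ι h) (λ _ → refl) w) ⟩
    g [] * ι h w                     ∎

  Δ-inject₁ : ∀ f u v → Δ f (map inject₁ u ++ 2F ∷ map inject₁ v) ≈ f (u ++ 0F ∷ v) + f (u ++ 1F ∷ v)
  Δ-inject₁ f []       v = trans (Δ-𝐭 f (map inject₁ v)) (+-cong (ι-inject₁ (∂ 0F f) v) (ι-inject₁ (∂ 1F f) v))
  Δ-inject₁ f (0F ∷ u) v = trans (Δ-𝐚 f (map inject₁ u ++ 2F ∷ map inject₁ v)) (Δ-inject₁ (∂ 0F f) u v)
  Δ-inject₁ f (1F ∷ u) v = trans (Δ-𝐛 f (map inject₁ u ++ 2F ∷ map inject₁ v)) (Δ-inject₁ (∂ 1F f) u v)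

  𝐭-product-inject₁ : ∀ g h u v → ⟨ g 𝐭 h ⟩ (map inject₁ u ++ 2F ∷ map inject₁ v) ≈ g u * h v
  𝐭-product-inject₁ g h []       v = trans (𝐭-product-𝐭 g h (map inject₁ v)) (*-congˡ (ι-inject₁ h v))
  𝐭-product-inject₁ g h (0F ∷ u) v = trans
    (𝐭-product-𝐚 g h (map inject₁ u ++ 2F ∷ map inject₁ v))
    (𝐭-product-inject₁ (∂ 0F g) h u v)
  𝐭-product-inject₁ g h (1F ∷ u) v = trans
    (𝐭-product-𝐛 g h (map inject₁ u ++ 2F ∷ map inject₁ v))
    (𝐭-product-inject₁ (∂ 1F g) h u v)

  module _ {n : ℕ} where

    -- Reading a letter differentiates f and the left factors but leaves the right factors alone.
    -- The matrix equation is not stable under this, so f, g and h are kept independent for the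
    -- induction.
    Δ-equation⁺ : ∀ f (g h : Fin n → Series 2) →
                  (∀ u v → f (u ++ 0F ∷ v) + f (u ++ 1F ∷ v) ≈ sum (λ z → g z u * h z v)) →
                  ∀ w → Δ f w ≈ sum (λ z → ⟨ g z 𝐭 h z ⟩ w)
    Δ-equation⁺ f g h split []       = trans (Δ-[] f) (sym (sum-zero _ (λ z → 𝐭-product-[] (g z) (h z))))
    Δ-equation⁺ f g h split (0F ∷ w) = trans (Δ-𝐚 f w) (trans
      (Δ-equation⁺ (∂ 0F f) (∂ 0F ∘ g) h (split ∘ (0F ∷_)) w)
      (sym (sum-cong-≋ (λ z → 𝐭-product-𝐚 (g z) (h z) w))))
    Δ-equation⁺ f g h split (1F ∷ w) = trans (Δ-𝐛 f w) (trans
      (Δ-equation⁺ (∂ 1F f) (∂ 1F ∘ g) h (split ∘ (1F ∷_)) w)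
      (sym (sum-cong-≋ (λ z → 𝐭-product-𝐛 (g z) (h z) w))))
    -- Everything before this 𝐭 has been absorbed into f and g, so `split []` is enough. A further 𝐭
    -- in w makes both sides zero.
    Δ-equation⁺ f g h split (2F ∷ w) = trans (Δ-𝐭 f w) (trans (equal (ι-support w))
      (sym (sum-cong-≋ (λ z → 𝐭-product-𝐭 (g z) (h z) w))))
      where
      equal : (∃ λ v → w ≡ map inject₁ v) ⊎ (∀ f → ι f w ≈ 0#) →
              ι (∂ 0F f) w + ι (∂ 1F f) w ≈ sum (λ z → g z [] * ι (h z) w)
      equal (inj₁ (v , ≡.refl)) = trans (+-cong (ι-inject₁ (∂ 0F f) v) (ι-inject₁ (∂ 1F f) v))
        (trans (split [] v) (sum-cong-≋ (λ z → *-congˡ (sym (ι-inject₁ (h z) v)))))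
      equal (inj₂ ι≈0) = trans (+-cong (ι≈0 _) (ι≈0 _)) (trans (+-identityˡ _)
        (sym (sum-zero _ (λ z → trans (*-congˡ (ι≈0 (h z))) (zeroʳ _)))))

    Δ-equation⁻ : ∀ f (g h : Fin n → Series 2) → (∀ w → Δ f w ≈ sum (λ z → ⟨ g z 𝐭 h z ⟩ w)) →
                  ∀ u v → f (u ++ 0F ∷ v) + f (u ++ 1F ∷ v) ≈ sum (λ z → g z u * h z v)
    Δ-equation⁻ f g h Δ≈ u v = trans (sym (Δ-inject₁ f u v)) (trans
      (Δ≈ (map inject₁ u ++ 2F ∷ map inject₁ v)) (sum-cong-≋ (λ z → 𝐭-product-inject₁ (g z) (h z) u v)))

  sum-coefficient : ∀ {q m} (F : Fin m → Series q) w →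
    RawSemiringDefinitions.sum (RawRing.rawSemiring (seriesRawRing q)) F w ≡ sum (λ z → F z w)
  sum-coefficient {m = zero}  F w = ≡.refl
  sum-coefficient {m = suc m} F w = ≡.cong (λ s → F 0F w + s) (sum-coefficient (F ∘ Fin.suc) w)

  product-coefficient : ∀ {n} (Φ : Matrix (Series 2) n) x y w →
    ((λ x y → ι (Φ x y) ⊛ 𝐭) · (λ x y → ι (Φ x y))) x y w ≡ sum (λ z → ⟨ Φ x z 𝐭 Φ z y ⟩ w)
  product-coefficient Φ x y w = sum-coefficient (λ z → ⟨ Φ x z 𝐭 Φ z y ⟩) w

  -- Products with powers of 𝐚 - 𝐛

  private
    𝐚-𝐛 : Series 2
    𝐚-𝐛 = 𝐚 ⊖ 𝐛

    𝐚-𝐛-[] : 𝐚-𝐛 [] ≈ 0#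
    𝐚-𝐛-[] = trans (+-identityˡ _) -0#≈0#

    ∂𝐚-𝐚-𝐛 : ∂ 0F 𝐚-𝐛 ≋ 𝟙
    ∂𝐚-𝐚-𝐛 w = trans (+-congˡ -0#≈0#) (+-identityʳ _)

    ∂𝐛-𝐚-𝐛 : ∂ 1F 𝐚-𝐛 ≋ ⊝ 𝟙
    ∂𝐛-𝐚-𝐛 w = +-identityˡ _

    𝐚-𝐛-⊛-[] : ∀ f → (𝐚-𝐛 ⊛ f) [] ≈ 0#
    𝐚-𝐛-⊛-[] f = ⊛-[]-const 𝐚-𝐛 f 𝐚-𝐛-[]

    𝐚-𝐛-⊛-𝐚 : ∀ f → ∂ 0F (𝐚-𝐛 ⊛ f) ≋ f
    𝐚-𝐛-⊛-𝐚 f w = trans (⊛-∷-const 𝐚-𝐛 f 0F w 𝐚-𝐛-[]) (𝟙-⊛ f ∂𝐚-𝐚-𝐛 w)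

    𝐚-𝐛-⊛-𝐛 : ∀ f → ∂ 1F (𝐚-𝐛 ⊛ f) ≋ ⊝ f
    𝐚-𝐛-⊛-𝐛 f w = trans (⊛-∷-const 𝐚-𝐛 f 1F w 𝐚-𝐛-[])
      (trans (⊛-congʳ f ∂𝐛-𝐚-𝐛 w) (trans (⊝-⊛ 𝟙 f w) (-‿cong (𝟙-⊛ f (λ _ → refl) w))))

  𝐚-𝐛^_ : ℕ → Series 2
  𝐚-𝐛^ j = 𝐚-𝐛 ↑ j

  𝐚-𝐛^-degree : ∀ j w → length w ≢ j → (𝐚-𝐛^ j) w ≈ 0#
  𝐚-𝐛^-degree zero    []       ≢ = contradiction ≡.refl ≢
  𝐚-𝐛^-degree zero    (x ∷ w)  ≢ = refl
  𝐚-𝐛^-degree (suc j) []       ≢ = 𝐚-𝐛-⊛-[] (𝐚-𝐛^ j)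
  𝐚-𝐛^-degree (suc j) (0F ∷ w) ≢ = trans (𝐚-𝐛-⊛-𝐚 (𝐚-𝐛^ j) w) (𝐚-𝐛^-degree j w (≢ ∘ ≡.cong suc))
  𝐚-𝐛^-degree (suc j) (1F ∷ w) ≢ =
    trans (𝐚-𝐛-⊛-𝐛 (𝐚-𝐛^ j) w) (trans (-‿cong (𝐚-𝐛^-degree j w (≢ ∘ ≡.cong suc))) -0#≈0#)

  -- The contribution of a first link climbing j + 1 levels: `wt x (z ∷ c) y` is
  -- `D (rank x z ∸ 1) (wt z c y)` by definition.
  D : ℕ → Series 2 → Series 2
  D j g = (𝐚-𝐛^ j) ⊛ (𝐛 ⊛ g)

  D-[] : ∀ j g → D j g [] ≈ 0#
  D-[] zero    g = trans (𝟙-⊛ (𝐛 ⊛ g) (λ _ → refl) []) (var-⊛-[] 1F g)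
  D-[] (suc j) g = ⊛-[]-const (𝐚-𝐛^ suc j) (𝐛 ⊛ g) (𝐚-𝐛-⊛-[] (𝐚-𝐛^ j))

  D-zero-𝐚 : ∀ g w → D 0 g (0F ∷ w) ≈ 0#
  D-zero-𝐚 g w = trans (𝟙-⊛ (𝐛 ⊛ g) (λ _ → refl) (0F ∷ w)) (var-⊛-∷ 1F g 0F w)

  D-zero-𝐛 : ∀ g w → D 0 g (1F ∷ w) ≈ g w
  D-zero-𝐛 g w = trans (𝟙-⊛ (𝐛 ⊛ g) (λ _ → refl) (1F ∷ w)) (var-⊛-∷ 1F g 1F w)

  D-suc-𝐚 : ∀ j g w → D (suc j) g (0F ∷ w) ≈ D j g w
  D-suc-𝐚 j g w = trans (⊛-∷-const (𝐚-𝐛^ suc j) (𝐛 ⊛ g) 0F w (𝐚-𝐛-⊛-[] (𝐚-𝐛^ j)))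
    (⊛-congʳ (𝐛 ⊛ g) (𝐚-𝐛-⊛-𝐚 (𝐚-𝐛^ j)) w)

  D-suc-𝐛 : ∀ j g w → D (suc j) g (1F ∷ w) ≈ - D j g w
  D-suc-𝐛 j g w = trans (⊛-∷-const (𝐚-𝐛^ suc j) (𝐛 ⊛ g) 1F w (𝐚-𝐛-⊛-[] (𝐚-𝐛^ j)))
    (trans (⊛-congʳ (𝐛 ⊛ g) (𝐚-𝐛-⊛-𝐛 (𝐚-𝐛^ j)) w) (⊝-⊛ (𝐚-𝐛^ j) (𝐛 ⊛ g) w))

  -- The factor in front of g is homogeneous of degree j + 1, so only the words that are j + 1
  -- letters shorter than w matter.
  D-cong : ∀ j {g g′} w → (∀ v → length w ≡ suc (j ℕ.+ length v) → g v ≈ g′ v) → D j g w ≈ D j g′ w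
  D-cong j {g} {g′} []        g≈g′ = trans (D-[] j g) (sym (D-[] j g′))
  D-cong zero {g} {g′} (0F ∷ w) g≈g′ = trans (D-zero-𝐚 g w) (sym (D-zero-𝐚 g′ w))
  D-cong zero {g} {g′} (1F ∷ w) g≈g′ = trans (D-zero-𝐛 g w) (trans (g≈g′ w ≡.refl) (sym (D-zero-𝐛 g′ w)))
  D-cong (suc j) {g} {g′} (0F ∷ w) g≈g′ = trans (D-suc-𝐚 j g w)
    (trans (D-cong j w (λ v eq → g≈g′ v (≡.cong suc eq))) (sym (D-suc-𝐚 j g′ w)))
  D-cong (suc j) {g} {g′} (1F ∷ w) g≈g′ = trans (D-suc-𝐛 j g w)
    (trans (-‿cong (D-cong j w (λ v eq → g≈g′ v (≡.cong suc eq)))) (sym (D-suc-𝐛 j g′ w)))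

  D-linear : ∀ {a} {A : Set a} j (r : A → Carrier) (f : A → Series 2) xs w →
             D j (λ v → Σ[ map (λ x → r x * f x v) xs ]) w ≈ Σ[ map (λ x → r x * D j (f x) w) xs ]
  D-linear j r f xs [] = trans
    (D-[] j (λ v → Σ[ map (λ x → r x * f x v) xs ]))
    (sym (Σ-zero (λ x → trans (*-congˡ (D-[] j (f x))) (zeroʳ _)) xs))
  D-linear zero r f xs (0F ∷ w) = trans (D-zero-𝐚 _ w)
    (sym (Σ-zero (λ x → trans (*-congˡ (D-zero-𝐚 (f x) w)) (zeroʳ _)) xs))
  D-linear zero r f xs (1F ∷ w) = trans (D-zero-𝐛 _ w) (Σ-cong (λ x → *-congˡ (sym (D-zero-𝐛 (f x) w))) xs)
  D-linear (suc j) r f xs (0F ∷ w) = trans (D-suc-𝐚 j _ w)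
    (trans (D-linear j r f xs w) (Σ-cong (λ x → *-congˡ (sym (D-suc-𝐚 j (f x) w))) xs))
  D-linear (suc j) r f xs (1F ∷ w) = trans (D-suc-𝐛 j _ w) (trans (-‿cong (D-linear j r f xs w))
    (trans (sym (Σ-neg _ xs)) (Σ-cong (λ x → trans (-‿distribʳ-* _ _) (*-congˡ (sym (D-suc-𝐛 j (f x) w)))) xs)))

  D-𝟘 : ∀ j w → D j 𝟘 w ≈ 0#
  -- The zero series as the empty linear combination.
  D-𝟘 j w = D-linear {A = ℕ} j (λ _ → 0#) (λ _ → 𝟘) [] w

  D-Σ : ∀ {a} {A : Set a} j (f : A → Series 2) xs w →
        D j (λ v → Σ[ map (λ x → f x v) xs ]) w ≈ Σ[ map (λ x → D j (f x) w) xs ]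
  D-Σ j f xs w = trans
    (D-cong j w (λ v _ → Σ-cong (λ x → sym (*-identityˡ (f x v))) xs))
    (trans (D-linear j (λ _ → 1#) f xs w) (Σ-cong (λ x → *-identityˡ _) xs))

  -- The recursion solving the system

  module Solution {n : ℕ} (κ : ℕ → Matrix Carrier n) where

    -- The value at u v for a fixed prefix u, when c k is the value at u 𝐚ᵏ.
    G : (ℕ → Matrix Carrier n) → List (Fin 2) → Matrix Carrier n
    G c []       = c 0
    G c (0F ∷ v) = G (c ∘ suc) v
    G c (1F ∷ v) = λ x y → sum (λ z → c 0 x z * G κ v z y) - G (c ∘ suc) v x y

    G-replicate : ∀ c k → G c (replicate k 0F) ≡ c k
    G-replicate c zero    = ≡.refl
    G-replicate c (suc k) = G-replicate (c ∘ suc) k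

    private
      *-matrix-assoc : ∀ (p : Fin n → Carrier) (A : Matrix Carrier n) (q : Fin n → Carrier) →
        sum (λ z → p z * sum (λ t → A z t * q t)) ≈ sum (λ t → sum (λ z → p z * A z t) * q t)
      *-matrix-assoc p A q = begin
        sum (λ z → p z * sum (λ t → A z t * q t))    ≈⟨ sum-cong-≋ {n} (λ z → trans (*-distribˡ-sum {n} (p z) _)
                                                          (sum-cong-≋ {n} (λ t → sym (*-assoc (p z) (A z t) (q t))))) ⟩
        sum (λ z → sum (λ t → p z * A z t * q t))    ≈⟨ ∑-comm (λ z t → p z * A z t * q t) ⟩
        sum (λ t → sum (λ z → p z * A z t * q t))    ≈⟨ sum-cong-≋ {n} (λ t → *-distribʳ-sum (q t) (λ z → p z * A z t)) ⟨
        sum (λ t → sum (λ z → p z * A z t) * q t)    ∎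

      difference-of-sums : ∀ a b d e → (a - b) + (d - e) ≈ (a + d) - (b + e)
      difference-of-sums a b d e = trans (interchange a (- b) d (- e)) (+-congˡ (-‿+-comm b e))

    -- For empty u this is the definition of `G` at 𝐛, and a leading 𝐚 only shifts `c`. For a
    -- leading 𝐛, both summands unfold to a product minus a shifted term. The relation for `κ`
    -- rewrites the products, the one for `c ∘ suc` the shifted terms, and associativity reassembles
    -- the result.
    G-split : ∀ c u v x y → G c (u ++ 0F ∷ v) x y + G c (u ++ 1F ∷ v) x y ≈ sum (λ z → G c u x z * G κ v z y)
    G-split c []       v x y = begin
      p + (s - p)    ≈⟨ +-congˡ (+-comm s (- p)) ⟩
      p + (- p + s)  ≈⟨ +-assoc p (- p) s ⟨
      p - p + s      ≈⟨ +-congʳ (-‿inverseʳ p) ⟩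
      0# + s         ≈⟨ +-identityˡ s ⟩
      s              ∎
      where
      p = G (c ∘ suc) v x y
      s = sum (λ z → c 0 x z * G κ v z y)
    G-split c (0F ∷ u) v x y = G-split (c ∘ suc) u v x y
    G-split c (1F ∷ u) v x y = begin
      (sum (λ z → c 0 x z * G κ (u ++ 0F ∷ v) z y) - G (c ∘ suc) (u ++ 0F ∷ v) x y) +
      (sum (λ z → c 0 x z * G κ (u ++ 1F ∷ v) z y) - G (c ∘ suc) (u ++ 1F ∷ v) x y)
        ≈⟨ difference-of-sums _ _ _ _ ⟩
      (sum (λ z → c 0 x z * G κ (u ++ 0F ∷ v) z y) + sum (λ z → c 0 x z * G κ (u ++ 1F ∷ v) z y)) -
      (G (c ∘ suc) (u ++ 0F ∷ v) x y + G (c ∘ suc) (u ++ 1F ∷ v) x y)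
        ≈⟨ +-cong (sym (∑-distrib-+ {n} _ _)) (-‿cong (G-split (c ∘ suc) u v x y)) ⟩
      sum (λ z → c 0 x z * G κ (u ++ 0F ∷ v) z y + c 0 x z * G κ (u ++ 1F ∷ v) z y) -
      sum (λ t → G (c ∘ suc) u x t * G κ v t y)
        ≈⟨ +-cong
             (sum-cong-≋ {n} (λ z → trans (sym (distribˡ (c 0 x z) _ _)) (*-congˡ (G-split κ u v z y))))
             (sym (sum-neg {n} _)) ⟩
      sum (λ z → c 0 x z * sum (λ t → G κ u z t * G κ v t y)) + sum (λ t → - (G (c ∘ suc) u x t * G κ v t y))
        ≈⟨ +-cong (*-matrix-assoc (c 0 x) (G κ u) (λ t → G κ v t y))
             (sum-cong-≋ {n} (λ t → -‿distribˡ-* _ _)) ⟩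
      sum (λ t → sum (λ z → c 0 x z * G κ u z t) * G κ v t y) + sum (λ t → - G (c ∘ suc) u x t * G κ v t y)
        ≈⟨ ∑-distrib-+ {n} _ _ ⟨
      sum (λ t → sum (λ z → c 0 x z * G κ u z t) * G κ v t y + - G (c ∘ suc) u x t * G κ v t y)
        ≈⟨ sum-cong-≋ {n} (λ t → sym (distribʳ (G κ v t y) _ _)) ⟩
      sum (λ t → G c (1F ∷ u) x t * G κ v t y) ∎

    module _ (Φ : Matrix (Series 2) n)
             (Φ-𝐚 : ∀ k x y → Φ x y (replicate k 0F) ≈ κ k x y)
             (Φ-split : ∀ u v x y → Φ x y (u ++ 0F ∷ v) + Φ x y (u ++ 1F ∷ v) ≈ sum (λ z → Φ x z u * Φ z y v)) where

      private
        -- The prefix u starts empty and grows by one 𝐚 at a time. At a 𝐛 the relation is solved for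
        -- the value in question: one part continues with 𝐚 in place of that 𝐛, the other restarts
        -- with empty prefix and family `κ`.
        prefixed : ∀ u v c → (∀ k x y → Φ x y (u ++ replicate k 0F) ≈ c k x y) → ∀ x y → Φ x y (u ++ v) ≈ G c v x y
        shifted : ∀ u v c → (∀ k x y → Φ x y (u ++ replicate k 0F) ≈ c k x y) →
                  ∀ x y → Φ x y (u ++ 0F ∷ v) ≈ G (c ∘ suc) v x y

        prefixed u []       c Φ≈c x y = Φ≈c 0 x y
        prefixed u (0F ∷ v) c Φ≈c x y = shifted u v c Φ≈c x y
        prefixed u (1F ∷ v) c Φ≈c x y = begin
          Φ x y (u ++ 1F ∷ v)
            ≈⟨ x≈z//y _ _ _ (trans (+-comm _ _) (Φ-split u v x y)) ⟩
          sum (λ z → Φ x z u * Φ z y v) - Φ x y (u ++ 0F ∷ v)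
            ≈⟨ +-cong
                 (sum-cong-≋ {n} (λ z → *-cong
                   (trans (reflexive (≡.cong (Φ x z) (≡.sym (List.++-identityʳ u)))) (Φ≈c 0 x z))
                   (prefixed [] v κ Φ-𝐚 z y)))
                 (-‿cong (shifted u v c Φ≈c x y)) ⟩
          sum (λ z → c 0 x z * G κ v z y) - G (c ∘ suc) v x y ∎

        shifted u v c Φ≈c x y = trans
          (reflexive (≡.cong (Φ x y) (≡.sym (List.++-assoc u [ 0F ] v))))
          (prefixed (u ++ [ 0F ]) v (c ∘ suc)
            (λ k x y → trans (reflexive (≡.cong (Φ x y) (List.++-assoc u [ 0F ] (replicate k 0F)))) (Φ≈c (suc k) x y)) x y)

      G-unique : ∀ w x y → Φ x y w ≈ G κ w x y
      G-unique w = prefixed [] w κ Φ-𝐚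

    -- Reading 𝐚 kills the term j = 0 and lowers every other j. Reading 𝐛 turns the term j = 0 into
    -- a value of `G κ` and negates the lowered rest. This is the recursion of `G`, with `c`
    -- shifting at each letter. The term j = |w| is zero by degree; on the poset side it belongs to
    -- the top level.
    G-expansion : ∀ c w x y →
      c (length w) x y * (𝐚-𝐛^ length w) w +
      sum (λ z → Σ< (suc (length w)) (λ j → c j x z * D j (λ v → G κ v z y) w)) ≈ G c w x y
    G-expansion c [] x y = trans
      (+-cong (*-identityʳ _)
        (sum-zero {n} _ (λ z → trans (+-identityʳ _) (trans (*-congˡ (D-[] 0 (λ v → G κ v z y))) (zeroʳ _)))))
      (+-identityʳ _)
    G-expansion c (0F ∷ w) x y = trans
      (+-cong
        (*-congˡ (𝐚-𝐛-⊛-𝐚 (𝐚-𝐛^ length w) w))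
        (sum-cong-≋ {n} (λ z → trans
          (+-cong (trans (*-congˡ (D-zero-𝐚 (λ v → G κ v z y) w)) (zeroʳ _))
            (Σ<-cong (suc (length w)) (λ j _ → *-congˡ {x = c (suc j) x z} (D-suc-𝐚 j (λ v → G κ v z y) w))))
          (+-identityˡ _))))
      (G-expansion (c ∘ suc) w x y)
    G-expansion c (1F ∷ w) x y = begin
      c (suc p) x y * (𝐚-𝐛^ suc p) (1F ∷ w) +
      sum (λ z → c 0 x z * D 0 (g z) (1F ∷ w) + Σ< (suc p) (λ j → c (suc j) x z * D (suc j) (g z) (1F ∷ w)))
        ≈⟨ +-cong
             (trans (*-congˡ (𝐚-𝐛-⊛-𝐛 (𝐚-𝐛^ p) w)) (sym (-‿distribʳ-* _ _)))
             (sum-cong-≋ {n} (λ z → +-cong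
               (*-congˡ (D-zero-𝐛 (g z) w))
               (trans
                 (Σ<-cong (suc p) (λ j _ → trans (*-congˡ (D-suc-𝐛 j (g z) w)) (sym (-‿distribʳ-* (c (suc j) x z) _))))
                 (Σ<-neg (suc p) (λ j → c (suc j) x z * D j (g z) w))))) ⟩
      - A + sum (λ z → c 0 x z * g z w + - B z)
        ≈⟨ +-congˡ (trans (∑-distrib-+ {n} _ _) (+-congˡ (sum-neg {n} B))) ⟩
      - A + (S + - sum B)
        ≈⟨ trans (sym (+-assoc _ _ _)) (trans (+-congʳ (+-comm _ _)) (+-assoc _ _ _)) ⟩
      S + (- A + - sum B)
        ≈⟨ +-congˡ (trans (-‿+-comm A (sum B)) (-‿cong (G-expansion (c ∘ suc) w x y))) ⟩
      S - G (c ∘ suc) w x y ∎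
      where
      p = length w
      g : Fin n → Series 2
      g z v = G κ v z y
      A = c (suc p) x y * (𝐚-𝐛^ p) w
      B : Fin n → Carrier
      B z = Σ< (suc p) (λ j → c (suc j) x z * D j (g z) w)
      S = sum (λ z → c 0 x z * g z w)

  -- Powers of `t` and 0/1 scalars

  t^-degree : ∀ m w → m ≢ length w → (t ↑ m) w ≈ 0#
  t^-degree zero    []       ≢ = contradiction ≡.refl ≢
  t^-degree zero    (x ∷ w)  ≢ = refl
  t^-degree (suc m) []       ≢ = var-⊛-[] 0F (t ↑ m)
  t^-degree (suc m) (0F ∷ w) ≢ = trans (var-⊛-∷ 0F (t ↑ m) 0F w) (t^-degree m w (≢ ∘ ≡.cong suc))

  t^-leading : ∀ w → (t ↑ length w) w ≈ 1#
  t^-leading []       = refl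
  t^-leading (0F ∷ w) = trans (var-⊛-∷ 0F (t ↑ length w) 0F w) (t^-leading w)

  bit-⊛ : ∀ b (f : Series 1) w → (((if b then 1 else 0) ⨯ 𝟙) ⊛ f) w ≈ (if b then 1# else 0#) * f w
  bit-⊛ true  f w = trans (𝟙-⊛ f (λ u → +-identityʳ (𝟙 u)) w) (sym (*-identityˡ _))
  bit-⊛ false f w = trans (𝟘-⊛ f (λ _ → refl) w) (sym (zeroˡ _))

  -- Sums over the chains of the level poset

  module Chains {n : ℕ} (M : Matrix ℕ n) where

    open LevelPoset M using (_<_; _≤_; _<?_; _≤?_; interval; <-transitive; i+k-i)
    open LocallyFiniteGradedPoset (levelPoset M) using (rank; chains)
    open ABIndex (levelPoset M) using (wt; Ψ[_,_])

    Element : Set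
    Element = Fin n × ℤ

    linked⇒< : ∀ {x y} c → Linked _<_ (x ∷ c ++ [ y ]) → x < y
    linked⇒< []      (x<y ∷ _) = x<y
    linked⇒< {x} {y} (z ∷ c) (x<z ∷ l) = <-transitive {x} {z} {y} x<z (linked⇒< {z} {y} c l)

    -- Ψ[ x , y ] is the case I = interval x y and N = rank x y.  The recursion on the least inner element z keeps
    -- I, although the interval shrinks to that from z to y: the surplus elements lie on no chain.
    chainSum : List Element → ℕ → Element → Element → Series 2
    chainSum I N x y w =
      Σ[ map (λ c → wt x c y w) (filter (λ c → linked? _<?_ (x ∷ c ++ [ y ])) (concatMap (tuples I) (upTo N))) ]

    -- With an indicator in place of the filter, the sum runs over all k-tuples and can be factored
    -- along the first entry.
    chainSumₖ : List Element → ℕ → Element → Element → Series 2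
    chainSumₖ I k x y w = Σ[ map (λ c → ⟦ linked? _<?_ (x ∷ c ++ [ y ]) ⟧ * wt x c y w) (tuples I k) ]

    -- This is what makes surplus elements of `I` harmless: no chain leads from them up to y.
    chainSum-≮ : ∀ I N x y w → ¬ (x < y) → chainSum I N x y w ≈ 0#
    chainSum-≮ I N x y w x≮y = reflexive (≡.cong (λ cs → Σ[ map (λ c → wt x c y w) cs ])
      (List.filter-none (λ c → linked? _<?_ (x ∷ c ++ [ y ]))
        (All.universal (λ c l → x≮y (linked⇒< {x} {y} c l)) (concatMap (tuples I) (upTo N)))))

    chainSum-by-length : ∀ I N x y w → chainSum I N x y w ≈ Σ[ map (λ k → chainSumₖ I k x y w) (upTo N) ]
    chainSum-by-length I N x y w = trans
      (Σ-filter (λ c → linked? _<?_ (x ∷ c ++ [ y ])) (λ c → wt x c y w) (concatMap (tuples I) (upTo N)))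
      (Σ-concatMap _ (tuples I) (upTo N))

    chainSumₖ-zero : ∀ I x y w → chainSumₖ I 0 x y w ≈ ⟦ x <? y ⟧ * (𝐚-𝐛^ (rank x y ∸ 1)) w
    chainSumₖ-zero I x y w = trans (+-identityʳ _)
      (trans (⟦⟧-×-* (does (x <? y)) true _) (*-congˡ (*-identityˡ _)))

    chainSumₖ-suc : ∀ I k x y w → chainSumₖ I (suc k) x y w ≈
                    Σ[ map (λ z → ⟦ x <? z ⟧ * D (rank x z ∸ 1) (chainSumₖ I k z y) w) I ]
    chainSumₖ-suc I k x y w = trans
      (Σ-cartesianProductWith _ _∷_ I (tuples I k))
      (Σ-cong (λ z → trans
        (Σ-cong (λ c → ⟦⟧-×-* (does (x <? z)) (does (linked? _<?_ (z ∷ c ++ [ y ]))) _) (tuples I k))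
        (trans (sym (*-Σ ⟦ x <? z ⟧ _ (tuples I k)))
          (*-congˡ (sym (D-linear (rank x z ∸ 1) _ (λ c → wt z c y) (tuples I k) w))))) I)

    -- A chain either has no inner element or is sorted by its least one, z, which leaves one inner
    -- element fewer. The bound `N` is the variable of the later inductions.
    chainSum-suc : ∀ I N x y w → chainSum I (suc N) x y w ≈
                   ⟦ x <? y ⟧ * (𝐚-𝐛^ (rank x y ∸ 1)) w +
                   Σ[ map (λ z → ⟦ x <? z ⟧ * D (rank x z ∸ 1) (chainSum I N z y) w) I ]
    chainSum-suc I N x y w = begin
      chainSum I (suc N) x y w
        ≈⟨ chainSum-by-length I (suc N) x y w ⟩
      chainSumₖ I 0 x y w + Σ[ map (λ k → chainSumₖ I k x y w) (applyUpTo suc N) ]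
        ≈⟨ +-cong (chainSumₖ-zero I x y w) (reflexive (≡.cong Σ[_]
             (≡.trans (≡.cong (map _) (≡.sym (List.map-upTo suc N))) (≡.sym (List.map-∘ (upTo N)))))) ⟩
      lead + Σ[ map (λ k → chainSumₖ I (suc k) x y w) (upTo N) ]
        ≈⟨ +-congˡ (Σ-cong (λ k → chainSumₖ-suc I k x y w) (upTo N)) ⟩
      lead + Σ[ map (λ k → Σ[ map (λ z → ⟦ x <? z ⟧ * D (rank x z ∸ 1) (chainSumₖ I k z y) w) I ]) (upTo N) ]
        ≈⟨ +-congˡ (Σ-swap _ (upTo N) I) ⟩
      lead + Σ[ map (λ z → Σ[ map (λ k → ⟦ x <? z ⟧ * D (rank x z ∸ 1) (chainSumₖ I k z y) w) (upTo N) ]) I ]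
        ≈⟨ +-congˡ (Σ-cong (λ z → trans
             (sym (*-Σ ⟦ x <? z ⟧ _ (upTo N)))
             (*-congˡ (trans
               (sym (D-Σ (rank x z ∸ 1) (λ k → chainSumₖ I k z y) (upTo N) w))
               (D-cong (rank x z ∸ 1) w (λ v _ → sym (chainSum-by-length I N z y v)))))) I) ⟩
      lead + Σ[ map (λ z → ⟦ x <? z ⟧ * D (rank x z ∸ 1) (chainSum I N z y) w) I ] ∎
      where lead = ⟦ x <? y ⟧ * (𝐚-𝐛^ (rank x y ∸ 1)) w

    -- The entries of Bin(Mʲ⁺¹), indexed by the degree j of the weight (𝐚 - 𝐛)ʲ and not by the rank
    -- difference j + 1.
    κ : ℕ → Matrix Carrier n
    κ j x y = ⟦ 0 ℕ.<? (M ^ᴺ suc j) x y ⟧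

    open Solution κ

    -- Levels against degrees

    module _ (u v : Fin n) {i j k : ℕ} (k≡ : k ≡ i ℕ.+ suc j) where

      rank-level : rank (u , pos i) (v , pos k) ≡ suc j
      rank-level = ≡.trans (≡.cong (λ l → ℤ.∣ pos l ℤ.- pos i ∣) k≡) (≡.cong ℤ.∣_∣ (i+k-i (pos i) (pos (suc j))))

      ⟦<?⟧-level : ⟦ (u , pos i) <? (v , pos k) ⟧ ≡ κ j u v
      ⟦<?⟧-level = ≡.cong₂ (λ b l → if b ∧ does (0 ℕ.<? (M ^ᴺ l) u v) then 1# else 0#)
        (dec-true (pos i ℤ.<? pos k) (ℤ.+<+ (≡.subst (i ℕ.<_) (≡.sym k≡) (ℕ.m<m+n i ℕ.z<s))))
        rank-level

      ⟦<?⟧-lead : ∀ w → ⟦ (u , pos i) <? (v , pos k) ⟧ * (𝐚-𝐛^ (rank (u , pos i) (v , pos k) ∸ 1)) w ≈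
                  κ j u v * (𝐚-𝐛^ j) w
      ⟦<?⟧-lead w = reflexive (≡.cong₂ (λ r l → r * (𝐚-𝐛^ (l ∸ 1)) w) ⟦<?⟧-level rank-level)

      ⟦<?⟧-D : ∀ g w → ⟦ (u , pos i) <? (v , pos k) ⟧ * D (rank (u , pos i) (v , pos k) ∸ 1) g w ≈ κ j u v * D j g w
      ⟦<?⟧-D g w = reflexive (≡.cong₂ (λ r l → r * D (l ∸ 1) g w) ⟦<?⟧-level rank-level)

    level-difference : ∀ {u v i k} → (u , pos i) < (v , pos k) → ∃ λ j → k ≡ i ℕ.+ suc j
    level-difference {i = i} (i<k , _) with j , suc-i+j≡k ← ℕ.m≤n⇒∃[o]m+o≡n (ℤ.drop‿+<+ i<k) =
      j , ≡.trans (≡.sym suc-i+j≡k) (≡.sym (ℕ.+-suc i j))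

    lead-vanishes : ∀ u v i k w → suc (i ℕ.+ length w) ≢ k →
      ⟦ (u , pos i) <? (v , pos k) ⟧ * (𝐚-𝐛^ (rank (u , pos i) (v , pos k) ∸ 1)) w ≈ 0#
    lead-vanishes u v i k w ≢k = ⟦⟧-*-zero ((u , pos i) <? (v , pos k)) λ u<v →
      let (j , k≡) = level-difference {u} {v} u<v in
      trans (reflexive (≡.cong (λ l → (𝐚-𝐛^ (l ∸ 1)) w) (rank-level u v k≡)))
        (𝐚-𝐛^-degree j w λ |w|≡j → ≢k
          (≡.trans (≡.sym (ℕ.+-suc i (length w))) (≡.trans (≡.cong (λ l → i ℕ.+ suc l) |w|≡j) (≡.sym k≡))))

    -- A link from level i to level k uses up k - i letters, so level plus word length is preserved.
    -- Only words w′ with this property have to be compared.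
    D-level-cong : ∀ u v i k {g g′} w →
      ((u , pos i) < (v , pos k) → ∀ w′ → k ℕ.+ length w′ ≡ i ℕ.+ length w → g w′ ≈ g′ w′) →
      ⟦ (u , pos i) <? (v , pos k) ⟧ * D (rank (u , pos i) (v , pos k) ∸ 1) g w ≈
      ⟦ (u , pos i) <? (v , pos k) ⟧ * D (rank (u , pos i) (v , pos k) ∸ 1) g′ w
    D-level-cong u v i k {g} {g′} w g≈g′ = ⟦⟧-*-cong ((u , pos i) <? (v , pos k)) λ u<v →
      let (j , k≡) = level-difference {u} {v} u<v in
      D-cong (rank (u , pos i) (v , pos k) ∸ 1) w λ w′ |w|≡ → g≈g′ u<v w′ (≡.trans
        (≡.cong (ℕ._+ length w′) k≡)
        (≡.trans (ℕ.+-assoc i (suc j) (length w′)) (≡.cong (i ℕ.+_) (≡.sym (≡.trans |w|≡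
          (≡.cong (λ l → suc (l ∸ 1 ℕ.+ length w′)) (rank-level u v k≡)))))))

    -- The 𝐚𝐛-index of one interval

    module Interval (s e : Fin n) (m : ℕ) where

      x₀ y₀ : Element
      x₀ = s , pos 0
      y₀ = e , pos (suc m)

      within? : ∀ z → Dec (x₀ ≤ z × z ≤ y₀)
      within? z = x₀ ≤? z ×-dec z ≤? y₀

      F : ℕ → Element → Series 2
      F N x = chainSum (interval x₀ y₀) N x y₀

      -- Trades the interval for the full grid of the m + 2 levels 0, ..., m + 1, with membership as
      -- an indicator. The distance between the end levels computes to `suc (m ℕ.+ 0)`, hence
      -- `+-identityʳ`.
      Σ-interval : ∀ h → Σ[ map h (interval x₀ y₀) ] ≈
                   sum (λ v → Σ< (2 ℕ.+ m) (λ k → ⟦ within? (v , pos k) ⟧ * h (v , pos k)))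
      Σ-interval h = trans
        (Σ-filter within? h (cartesianProduct (allFin n) levels))
        (trans (Σ-cartesianProductWith h′ _,_ (allFin n) levels)
          (trans (Σ-tabulate {n = n} (λ v → Σ[ map (λ z → h′ (v , z)) levels ]) id)
            (sum-cong-≋ {n} (λ v → reflexive (≡.cong Σ[_] (≡.trans
              (≡.sym (List.map-∘ (upTo L)))
              (≡.trans (List.map-upTo (λ k → h′ (v , pos k)) L)
                (≡.cong (λ l → applyUpTo (λ k → h′ (v , pos k)) (2 ℕ.+ l)) (ℕ.+-identityʳ m)))))))))
        where
        L = suc ℤ.∣ pos (suc m) ℤ.- pos 0 ∣
        levels = map (λ k → pos 0 ℤ.+ pos k) (upTo L)
        h′ : Element → Carrier
        h′ z = ⟦ within? z ⟧ * h z

      term : ℕ → Fin n → ℕ → Fin n → ℕ → List (Fin 2) → Carrier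
      term N u i v k w = ⟦ (u , pos i) <? (v , pos k) ⟧ * D (rank (u , pos i) (v , pos k) ∸ 1) (F N (v , pos k)) w

      F-suc : ∀ N u i w → F (suc N) (u , pos i) w ≈
              ⟦ (u , pos i) <? y₀ ⟧ * (𝐚-𝐛^ (rank (u , pos i) y₀ ∸ 1)) w +
              sum (λ v → Σ< (2 ℕ.+ m) (λ k → ⟦ within? (v , pos k) ⟧ * term N u i v k w))
      F-suc N u i w = trans
        (chainSum-suc (interval x₀ y₀) N (u , pos i) y₀ w)
        (+-congˡ (Σ-interval (λ z → ⟦ (u , pos i) <? z ⟧ * D (rank (u , pos i) z ∸ 1) (F N z) w)))

      -- Each link preserves i + |w|, and a final link contributes only when this sum is m. In
      -- `abSeries` this removes all intervals except the one with m = |w|.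
      F-degree : ∀ N u i w → i ℕ.+ length w ≢ m → F N (u , pos i) w ≈ 0#
      F-degree zero    u i w ≢m = refl
      F-degree (suc N) u i w ≢m = trans (F-suc N u i w) (trans
        (+-cong
          (lead-vanishes u e i (suc m) w (≢m ∘ ℕ.suc-injective))
          (sum-zero {n} _ (λ v → Σ<-zero (2 ℕ.+ m) (λ k → ⟦⟧-*-zero (within? (v , pos k)) (λ _ → trans
            (D-level-cong u v i k {g′ = 𝟘} w
              (λ _ w′ eq → F-degree N v k w′ (≢m ∘ ≡.trans (≡.sym eq))))
            (trans (*-congˡ (D-𝟘 (rank (u , pos i) (v , pos k) ∸ 1) w)) (zeroʳ _)))))))
        (+-identityˡ 0#))

      ≤-<-transitive : ∀ {x z} → x₀ ≤ x → x < z → x₀ ≤ z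
      ≤-<-transitive {x} {z} (inj₁ x₀<x)   x<z = inj₁ (<-transitive {x₀} {x} {z} x₀<x x<z)
      ≤-<-transitive         (inj₂ ≡.refl) x<z = inj₁ x<z

      within-redundant : ∀ N u i v k w → x₀ ≤ (u , pos i) →
                         ⟦ within? (v , pos k) ⟧ * term N u i v k w ≈ term N u i v k w
      within-redundant N u i v k w x₀≤u = by-cases ((u , pos i) <? (v , pos k)) ((v , pos k) <? y₀)
        where
        by-cases : Dec ((u , pos i) < (v , pos k)) → Dec ((v , pos k) < y₀) →
                   ⟦ within? (v , pos k) ⟧ * term N u i v k w ≈ term N u i v k w
        by-cases (yes u<v) (yes v<y) = trans
          (*-congʳ (reflexive (⟦⟧-yes (within? (v , pos k)) (≤-<-transitive {z = v , pos k} x₀≤u u<v , inj₁ v<y))))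
          (*-identityˡ _)
        by-cases (no u≮v) _ = trans (*-congˡ vanish) (trans (zeroʳ _) (sym vanish))
          where
          vanish : term N u i v k w ≈ 0#
          vanish = ⟦⟧-*-zero ((u , pos i) <? (v , pos k)) (λ u<v → contradiction u<v u≮v)
        -- This includes v = y₀, which lies in the interval but starts no chain to itself.
        by-cases (yes _) (no v≮y) = trans (*-congˡ vanish) (trans (zeroʳ _) (sym vanish))
          where
          vanish : term N u i v k w ≈ 0#
          vanish = trans
            (*-congˡ (trans
              (D-cong (rank (u , pos i) (v , pos k) ∸ 1) w
                (λ w′ _ → chainSum-≮ (interval x₀ y₀) N (v , pos k) y₀ w′ v≮y))
              (D-𝟘 (rank (u , pos i) (v , pos k) ∸ 1) w)))
            (zeroʳ _)

      -- Every link uses at least one letter, so |w| < N ensures that the cutoff `N` loses no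
      -- relevant chain. With i + |w| = m the answer depends on w and the two vertices but not on
      -- the level, as `G` requires.
      F≈G : ∀ N u i w → length w ℕ.< N → i ℕ.+ length w ≡ m → x₀ ≤ (u , pos i) → F N (u , pos i) w ≈ G κ w u e
      F≈G (suc N) u i w |w|<N i+|w|≡m x₀≤u = begin
        F (suc N) (u , pos i) w
          ≈⟨ F-suc N u i w ⟩
        ⟦ (u , pos i) <? y₀ ⟧ * (𝐚-𝐛^ (rank (u , pos i) y₀ ∸ 1)) w +
        sum (λ v → Σ< (2 ℕ.+ m) (λ k → ⟦ within? (v , pos k) ⟧ * term N u i v k w))
          ≈⟨ +-cong
               (⟦<?⟧-lead u e (≡.trans (≡.cong suc (≡.sym i+|w|≡m)) (≡.sym (ℕ.+-suc i p))) w)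
               (sum-cong-≋ {n} inner) ⟩
        κ p u e * (𝐚-𝐛^ p) w + sum (λ v → Σ< (suc p) (λ j → κ j u v * D j (λ w′ → G κ w′ v e) w))
          ≈⟨ G-expansion κ w u e ⟩
        G κ w u e ∎
        where
        p = length w

        summand : Fin n → ℕ → Carrier
        summand v k = ⟦ (u , pos i) <? (v , pos k) ⟧ * D (rank (u , pos i) (v , pos k) ∸ 1) (λ w′ → G κ w′ v e) w

        inner : ∀ v → Σ< (2 ℕ.+ m) (λ k → ⟦ within? (v , pos k) ⟧ * term N u i v k w) ≈
                      Σ< (suc p) (λ j → κ j u v * D j (λ w′ → G κ w′ v e) w)
        inner v = begin
          Σ< (2 ℕ.+ m) (λ k → ⟦ within? (v , pos k) ⟧ * term N u i v k w)
            ≈⟨ Σ<-cong (2 ℕ.+ m) (λ k _ → trans (within-redundant N u i v k w x₀≤u)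
                 (D-level-cong u v i k w (λ u<v w′ eq → F≈G N v k w′
                   (shorter (level-difference {u} {v} u<v) w′ eq)
                   (≡.trans eq i+|w|≡m) (≤-<-transitive {z = v , pos k} x₀≤u u<v)))) ⟩
          Σ< (2 ℕ.+ m) (summand v)
            ≈⟨ reflexive (≡.cong (λ l → Σ< l (summand v))
                 (≡.cong suc (≡.trans (≡.cong suc (≡.sym i+|w|≡m)) (≡.sym (ℕ.+-suc i p))))) ⟩
          Σ< (suc i ℕ.+ suc p) (summand v)
            -- Levels 0, ..., i contain nothing above (u, i). The remaining level i + 1 + j
            -- corresponds to degree j, and j = p is the level of y₀.
            ≈⟨ Σ<-drop (suc i) (suc p) (summand v) (λ k k<1+i → ⟦⟧-*-zero ((u , pos i) <? (v , pos k))
                 (λ u<v → contradiction (ℤ.drop‿+<+ (proj₁ u<v)) (ℕ.≤⇒≯ (ℕ.s≤s⁻¹ k<1+i)))) ⟩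
          Σ< (suc p) (λ j → summand v (suc i ℕ.+ j))
            ≈⟨ Σ<-cong (suc p) (λ j _ → ⟦<?⟧-D u v (≡.sym (ℕ.+-suc i j)) (λ w′ → G κ w′ v e) w) ⟩
          Σ< (suc p) (λ j → κ j u v * D j (λ w′ → G κ w′ v e) w) ∎
          where
          shorter : ∀ {k} → (∃ λ j → k ≡ i ℕ.+ suc j) → ∀ w′ → k ℕ.+ length w′ ≡ i ℕ.+ p → length w′ ℕ.< N
          shorter (j , ≡.refl) w′ eq = ℕ.<-≤-trans
            (ℕ.m≤n+m (suc (length w′)) j)
            (ℕ.≤-trans (ℕ.≤-reflexive (≡.trans (ℕ.+-suc j (length w′))
              (ℕ.+-cancelˡ-≡ i _ _ (≡.trans (≡.sym (ℕ.+-assoc i (suc j) (length w′))) eq))))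
              (ℕ.s≤s⁻¹ |w|<N))

      Ψ₀ : Series 2
      Ψ₀ = if does (x₀ ≤? y₀) then Ψ[ x₀ , y₀ ] else 𝟘

      Ψ₀-coefficient : ∀ w → Ψ₀ w ≈ F (suc m) x₀ w
      Ψ₀-coefficient w = by-cases (x₀ ≤? y₀)
        where
        foldr-coefficient : ∀ cs → foldr _⊕_ 𝟘 (map (λ c → wt x₀ c y₀) cs) w ≡ Σ[ map (λ c → wt x₀ c y₀ w) cs ]
        foldr-coefficient []       = ≡.refl
        foldr-coefficient (c ∷ cs) = ≡.cong (λ r → wt x₀ c y₀ w + r) (foldr-coefficient cs)

        by-cases : (d : Dec (x₀ ≤ y₀)) → (if does d then Ψ[ x₀ , y₀ ] else 𝟘) w ≈ F (suc m) x₀ w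
        by-cases (yes _)     = reflexive (≡.trans
          (foldr-coefficient (chains x₀ y₀)) (≡.cong (λ l → F (suc l) x₀ w) (ℕ.+-identityʳ m)))
        -- The default value 0 agrees with the sum over the empty set of chains.
        by-cases (no x₀≰y₀) = sym (chainSum-≮ (interval x₀ y₀) (suc m) x₀ y₀ w (x₀≰y₀ ∘ inj₁))

    abSeries-coefficient : ∀ x y w → abSeries M x y w ≈ G κ w x y
    abSeries-coefficient x y w = trans
      (Σ∞-homogeneous I.Ψ₀ w (λ m m≢ → trans (I.Ψ₀-coefficient m w) (I.F-degree m (suc m) x 0 w (m≢ ∘ ≡.sym))))
      (trans (I.Ψ₀-coefficient (length w) w)
        (I.F≈G (length w) (suc (length w)) x 0 w (ℕ.n<1+n _) ≡.refl (inj₂ ≡.refl)))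
      where module I m = Interval x y m

    -- The coefficients of K(t), existence and uniqueness

    module _ (binary : IsBinary M) where

      -- For positive m this is the definition of `Bin`. For m = 0 the entry is that of M itself,
      -- which equals its own indicator because M is binary. Positivity of M and of `M ^ᴺ 1`, the
      -- product of M with the identity, is compared through paths of one step.
      Kcoefficient-bit : ∀ m x y → Kcoefficient M m x y ≡ (if does (0 ℕ.<? (M ^ᴺ suc m) x y) then 1 else 0)
      Kcoefficient-bit (suc m) x y with (M ^ᴺ (2 ℕ.+ m)) x y
      ... | zero  = ≡.refl
      ... | suc _ = ≡.refl
      Kcoefficient-bit zero x y with 0 ℕ.<? M x y
      ... | yes 0<M = ≡.trans (one (binary x y)) (≡.sym (≡.cong (if_then 1 else 0) (dec-true (0 ℕ.<? (M ^ᴺ 1) x y)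
              (LevelPoset.step⁺ M 0 0<M (LevelPoset.𝟏-refl M y)))))
        where
        one : M x y ≡ 0 ⊎ M x y ≡ 1 → M x y ≡ 1
        one (inj₁ M≡0) = contradiction (≡.sym M≡0) (ℕ.<⇒≢ 0<M)
        one (inj₂ M≡1) = M≡1
      ... | no ≮ = ≡.trans (ℕ.n≤0⇒n≡0 (ℕ.≮⇒≥ ≮)) (≡.sym (≡.cong (if_then 1 else 0) (dec-false (0 ℕ.<? (M ^ᴺ 1) x y)
              (λ 0<M¹ → ≮ (from-step (LevelPoset.step⁻ M 0 0<M¹))))))
        where
        from-step : (∃ λ v → 0 ℕ.< M x v × 0 ℕ.< (M ^ᴺ 0) v y) → 0 ℕ.< M x y
        from-step (v , 0<M , 0<𝟏) with v Fin.≟ y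
        from-step (v , 0<M , 0<𝟏) | yes ≡.refl = 0<M
        from-step (v , 0<M , ())  | no _

      K-term : ∀ x y w m → ((Kcoefficient M m x y ⨯ 𝟙) ⊛ (t ↑ m)) w ≈ κ m x y * (t ↑ m) w
      K-term x y w m = trans
        (reflexive (≡.cong (λ b → ((b ⨯ 𝟙) ⊛ (t ↑ m)) w) (Kcoefficient-bit m x y)))
        (bit-⊛ (does (0 ℕ.<? (M ^ᴺ suc m) x y)) (t ↑ m) w)

      K-coefficient : ∀ x y w → K M x y w ≈ κ (length w) x y
      K-coefficient x y w = trans
        (Σ∞-homogeneous (λ m → (Kcoefficient M m x y ⨯ 𝟙) ⊛ (t ↑ m)) w
          (λ m m≢ → trans (K-term x y w m) (trans (*-congˡ (t^-degree m w m≢)) (zeroʳ _))))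
        (trans (K-term x y w (length w)) (trans (*-congˡ (t^-leading w)) (*-identityʳ _)))

      solution : ∀ Φ → (∀ x y w → Φ x y w ≈ G κ w x y) → SatisfiesSystem M Φ
      solution Φ Φ≈G =
        (λ x y w → trans (𝐚=t,𝐛=0-coefficient (Φ x y) w) (trans (Φ≈G x y _)
          (trans (reflexive (≡.cong (λ A → A x y) (G-replicate κ (length w)))) (sym (K-coefficient x y w))))) ,
        (λ x y w → trans
          (Δ-equation⁺ (Φ x y) (Φ x) (λ z → Φ z y)
            (λ u v → trans (+-cong (Φ≈G x y _) (Φ≈G x y _)) (trans (G-split κ u v x y)
              (sym (sum-cong-≋ {n} (λ z → *-cong (Φ≈G x z u) (Φ≈G z y v))))))
            w)
          (reflexive (≡.sym (product-coefficient Φ x y w))))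

      solution-unique : ∀ Φ → SatisfiesSystem M Φ → ∀ x y w → Φ x y w ≈ G κ w x y
      solution-unique Φ (initial , derivation) x y w = G-unique Φ
        (λ k x y → begin
          Φ x y (replicate k 0F)
            ≈⟨ reflexive (≡.cong (λ l → Φ x y (replicate l 0F)) (≡.sym (List.length-replicate k))) ⟩
          Φ x y (replicate (length (replicate k 0F)) 0F)
            ≈⟨ 𝐚=t,𝐛=0-coefficient (Φ x y) (replicate k 0F) ⟨
          (Φ x y ∣𝐚=t,𝐛=0) (replicate k 0F)
            ≈⟨ initial x y (replicate k 0F) ⟩
          K M x y (replicate k 0F)
            ≈⟨ K-coefficient x y (replicate k 0F) ⟩
          κ (length (replicate k 0F)) x y
            ≈⟨ reflexive (≡.cong (λ l → κ l x y) (List.length-replicate k)) ⟩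
          κ k x y ∎)
        (λ u v x y → Δ-equation⁻ (Φ x y) (Φ x) (λ z → Φ z y)
          (λ w → trans (derivation x y w) (reflexive (product-coefficient Φ x y w))) u v)
        w x y

      abSeries-unique-solution : SatisfiesSystem M (abSeries M) × (∀ Φ → SatisfiesSystem M Φ → Φ ≈ₘ abSeries M)
      abSeries-unique-solution =
        solution (abSeries M) abSeries-coefficient ,
        λ Φ system x y w → trans (solution-unique Φ system x y w) (sym (abSeries-coefficient x y w))

open import Defs

theorem8p1 : (n : ℕ) .{{_ : NonZero n}} (M : Matrix ℕ n) → IsBinary M →
    SatisfiesSystem M (abSeries M) ×
    ((Φ : Matrix (Series 2) n) → SatisfiesSystem M Φ → Φ ≈ₘ abSeries M)
theorem8p1 n M binary = Coefficients.Chains.abSeries-unique-solution ℝ-commutativeRing M binary
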